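{- Let $\mathcal{H}$ be a connected hypergraph, $v\in V(\mathcal{H})$, and let $(\mathcal{T},r)$ with labeling $\pi$ be the Weitz-hypertree of $\mathcal{H}$ at $v$. Let $\bm\lambda'_u=\bm\lambda_{\pi(u)}$ for $u\in V(\mathcal{T})$. Then $Z(\mathcal{H};\bm\lambda)$ divides $Z(\mathcal{T};\bm\lambda')$ as polynomials in $\bm\lambda$; in particular, if $Z(\mathcal{H};\bm\lambda)=0$ for some $\bm\lambda\in\mathbb{C}^{V(\mathcal{H})}$, then $Z(\mathcal{T};\bm\lambda')=0$. Moreover, there exist subhypergraphs $\mathcal{H}_1,\dots,\mathcal{H}_l$ of $\mathcal{H}$ with vertex sets contained in $V(\mathcal{H})\setminus\{v\}$ and integers $k_j\ge 1$ such that \[ Z(\mathcal{T};\bm\lambda')=Z(\mathcal{H};\bm\lambda)\prod_{j=1}^lZ(\mathcal{H}_j;\bm\lambda)^{k_j}. \]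
   Context: A hypergraph $\mathcal{H}=(V,E)$ has finite vertex set and a set $E$ of nonempty subsets of $V$. $Z(\mathcal{H};\bm\lambda)=\sum_{U}\prod_{u\in U}\bm\lambda_u$ over $U\subseteq V$ containing no hyperedge; for a hypergraph $\mathcal{H}'$ on $V'\subseteq V$, $Z(\mathcal{H}';\bm\lambda)$ means $Z(\mathcal{H}';\bm\lambda|_{V'})$. Operations: for $S\subseteq V$, $\mathcal{H}-S$ is the hypergraph on $V\setminus S$ with hyperedges $\{e\in E: e\cap S=\emptyset\}$; $\mathcal{H}\ominus S$ is the hypergraph on $V\setminus S$ with hyperedges $\{e\setminus S: e\in E, e\not\subseteq S\}$; for $F\subseteq E$, $\mathcal{H}-F=(V,E\setminus F)$. A subhypergraph of $\mathcal{H}$ is any hypergraph obtained from $\mathcal{H}$ by a combination of these operations. A linear hypertree is a hypergraph in which distinct hyperedges share at most one vertex and between any two vertices there is a unique path $(u_1,e_1,\dots,e_{n-1},u_n)$ (distinct vertices, distinct edges, $\{u_i,u_{i+1}\}\subseteq e_i$). Weitz-hypertree (recursive): if $\mathcal{H}$ is a linear hypertree, $\mathcal{T}=\mathcal{H}$, $r=v$, $\pi=\mathrm{id}$. Otherwise let $e_1,\dots,e_d$ be the hyperedges containing $v$ in a fixed order, $e_i=\{v,v^{(i)}_1,\dots,v^{(i)}_{b_i}\}$; for each $i,j$ let $(\mathcal{T}^{(i)}_j,r^{(i)}_j)$, $\pi^{(i)}_j$ be the Weitz-hypertree at $v^{(i)}_j$ of the connected component of $v^{(i)}_j$ in $(\mathcal{H}-\{e_1,\dots,e_i\})\ominus\{v,v^{(i)}_1,\dots,v^{(i)}_{j-1}\}$.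 Then $\mathcal{T}$ is the disjoint union of the $\mathcal{T}^{(i)}_j$ together with a new vertex $r$ and hyperedges $\{r,r^{(i)}_1,\dots,r^{(i)}_{b_i}\}$, $i=1,\dots,d$; $\pi(r)=v$ and $\pi=\pi^{(i)}_j$ on $V(\mathcal{T}^{(i)}_j)$. -}

module Defs where

open import Level using (0ℓ)
open import Data.Nat.Base using (ℕ; zero; suc; _+_)
open import Data.Bool.Base using (Bool; true; false; if_then_else_; _∧_; not)
open import Data.Fin.Base using (Fin; zero; suc; toℕ; fromℕ; inject₁; _↑ˡ_; _↑ʳ_; splitAt)
open import Data.Fin.Subset
  using (Subset; _∈_; _∉_; _⊆_; _∩_; _∪_; _─_; ∁; ⁅_⁆; ⋃; Nonempty; Empty)
  renaming (⊥ to ∅ₛ; ⊤ to fullₛ)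
open import Data.Fin.Subset.Properties using (_⊆?_; nonempty?)
open import Data.Vec.Base as Vec using (Vec; []; _∷_; replicate; toList)
import Data.Vec.Properties as VecP
open import Data.List.Base as List using (List; []; _∷_; _++_; map; filter; foldr; take; length; tabulate)
open import Data.Bool.ListAction using (any)
open import Data.List.Relation.Unary.Unique.Propositional using (Unique)
open import Data.List.Membership.Propositional using () renaming (_∈_ to _∈ₗ_)
import Data.List.Membership.DecPropositional as DecMem
import Data.Bool.Properties as BoolP
open import Data.Product using (Σ; Σ-syntax; ∃; ∃-syntax; _×_; _,_; proj₁; proj₂)
open import Data.Sum.Base using ([_,_])
open import Function.Base using (id; _∘_)
open import Function.Definitions using (Injective)
open import Function.Bundles using (_⇔_)
open import Relation.Nullary using (¬_; Dec; does; ¬?)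
open import Relation.Binary.PropositionalEquality using (_≡_; _≢_)
open import Algebra.Bundles using (CommutativeRing)

-- Hypergraphs.
-- A hypergraph on (a subset of) the ambient vertex type Fin n:
-- `verts` is its vertex set V ⊆ Fin n, `edges` lists its hyperedges.
-- The edge SET E is the set of subsets occurring in the list; all notions
-- below are insensitive to repetitions in the list.

record Hypergraph (n : ℕ) : Set where
  constructor hypergraph
  field
    verts : Subset n
    edges : List (Subset n)
open Hypergraph public

WellFormed : ∀ {n} → Hypergraph n → Set
WellFormed H = ∀ e → e ∈ₗ edges H → Nonempty e × e ⊆ verts H

_≟ₛ_ : ∀ {n} (p q : Subset n) → Dec (p ≡ q)
_≟ₛ_ = VecP.≡-dec BoolP._≟_

setOf : ∀ {n} → List (Fin n) → Subset n
setOf xs = ⋃ (map ⁅_⁆ xs)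

delV : ∀ {n} → Hypergraph n → Subset n → Hypergraph n
delV H S = hypergraph (verts H ─ S) (filter (λ e → ¬? (nonempty? (e ∩ S))) (edges H))

contr : ∀ {n} → Hypergraph n → Subset n → Hypergraph n
contr H S = hypergraph (verts H ─ S)
  (map (λ e → e ─ S) (filter (λ e → ¬? (e ⊆? S)) (edges H)))

delE : ∀ {n} → Hypergraph n → List (Subset n) → Hypergraph n
delE {n} H F = hypergraph (verts H) (filter (λ e → ¬? (e ∈? F)) (edges H))
  where open DecMem (_≟ₛ_ {n})

data IsSub {n} (H : Hypergraph n) : Hypergraph n → Set where
  sub-refl : IsSub H H
  sub-delV : ∀ {G} → IsSub H G → (S : Subset n) → IsSub H (delV G S)
  sub-contr : ∀ {G} → IsSub H G → (S : Subset n) → IsSub H (contr G S)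
  sub-delE : ∀ {G} → IsSub H G → (F : List (Subset n)) → IsSub H (delE G F)

data Reach {n} (H : Hypergraph n) (u : Fin n) : Fin n → Set where
  here : u ∈ verts H → Reach H u u
  step : ∀ {x y e} → Reach H u x → e ∈ₗ edges H → x ∈ e → y ∈ e → Reach H u y

Connected : ∀ {n} → Hypergraph n → Set
Connected H = ∀ u w → u ∈ verts H → w ∈ verts H → Reach H u w

Component : ∀ {n} → Hypergraph n → Fin n → Hypergraph n → Set
Component H u C =
  Σ[ K ∈ Subset _ ] ((∀ w → (w ∈ K) ⇔ Reach H u w) × C ≡ delV H (verts H ─ K))

record Path {n} (H : Hypergraph n) (u w : Fin n) : Set where
  field
    len : ℕ
    vs : Vec (Fin n) (suc len)
    es : Vec (Subset n) len
    start : Vec.lookup vs zero ≡ u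
    end : Vec.lookup vs (fromℕ len) ≡ w
    vs-in : ∀ i → Vec.lookup vs i ∈ verts H
    es-in : ∀ i → Vec.lookup es i ∈ₗ edges H
    link : ∀ i → Vec.lookup vs (inject₁ i) ∈ Vec.lookup es i
               × Vec.lookup vs (suc i) ∈ Vec.lookup es i
    vs-distinct : Injective _≡_ _≡_ (Vec.lookup vs)
    es-distinct : Injective _≡_ _≡_ (Vec.lookup es)
open Path public

LinearHypertree : ∀ {n} → Hypergraph n → Set
LinearHypertree {n} H =
  (∀ e f → e ∈ₗ edges H → f ∈ₗ edges H → e ≢ f →
     ∀ x y → x ∈ e → x ∈ f → y ∈ e → y ∈ f → x ≡ y)
  × (∀ u w → u ∈ verts H → w ∈ verts H →
       Σ[ p ∈ Path H u w ] (∀ (q : Path H u w) →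
          toList (vs p) ≡ toList (vs q) × toList (es p) ≡ toList (es q)))

record RTree (n : ℕ) : Set where
  constructor rtree
  field
    size : ℕ
    hg : Hypergraph size
    root : Fin size
    lab : Fin size → Fin n
open RTree public

record Piece (n : ℕ) : Set where
  constructor piece
  field
    psize : ℕ
    phg : Hypergraph psize
    plab : Fin psize → Fin n
    marks : List (Subset psize)
open Piece public

liftL : ∀ {m} k → Subset m → Subset (m + k)
liftL k p = p Vec.++ replicate k false

liftR : ∀ m {k} → Subset k → Subset (m + k)
liftR m p = replicate m false Vec.++ p

emptyPiece : ∀ {n} → Piece n
emptyPiece = piece 0 (hypergraph [] []) (λ ()) []

_⊕_ : ∀ {n} → Piece n → Piece n → Piece n
piece m G f ms ⊕ piece k G' f' ms' =
  piece (m + k)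
    (hypergraph (verts G Vec.++ verts G')
                (map (liftL k) (edges G) ++ map (liftR m) (edges G')))
    ([ f , f' ] ∘ splitAt m)
    (map (liftL k) ms ++ map (liftR m) ms')

treePiece : ∀ {n} → RTree n → Piece n
treePiece (rtree m T r π) = piece m T π (⁅ r ⁆ ∷ [])

groupPiece : ∀ {n} → List (RTree n) → Piece n
groupPiece ts with foldr _⊕_ emptyPiece (map treePiece ts)
... | piece m G f ms = piece m G f (⋃ ms ∷ [])

-- new root r labelled v, the disjoint union of all trees, and for each
-- group i the hyperedge {r} ∪ {roots of the trees of group i}
assemble : ∀ {n} → Fin n → List (List (RTree n)) → RTree n
assemble v gs with foldr _⊕_ emptyPiece (map groupPiece gs)
... | piece m G f ms =
  rtree (suc m)
    (hypergraph (true ∷ verts G) (map (false ∷_) (edges G) ++ map (true ∷_) ms))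
    zero
    (λ { zero → v ; (suc x) → f x })

-- Weitz-hypertree (relational form of the recursive definition).
-- Weitz H v t : t = (T , r , π) is a Weitz-hypertree of H at v, for some
-- choice of the fixed orderings of the hyperedges at v and of the vertices
-- of each hyperedge.

-- (H - {e₁,…,e_{i}}) ⊖ {v, v⁽ⁱ⁾₁, …, v⁽ⁱ⁾_{j-1}}   (i, j 0-based below)
stepGraph : ∀ {n} → Hypergraph n → Fin n → (es : List (Subset n)) →
            Fin (length es) → List (Fin n) → ℕ → Hypergraph n
stepGraph H v es i ws j =
  contr (delE H (take (suc (toℕ i)) es)) (⁅ v ⁆ ∪ setOf (take j ws))

data Weitz {n} : Hypergraph n → Fin n → RTree n → Set where
  base : ∀ {H v} → LinearHypertree H → Weitz H v (rtree n H v id)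
  step : ∀ {H v} → ¬ LinearHypertree H →
    (es : List (Subset n)) → Unique es →
    (∀ e → (e ∈ₗ es) ⇔ (e ∈ₗ edges H × v ∈ e)) →
    (ws : Fin (length es) → List (Fin n)) →
    (∀ i → Unique (ws i)) →
    (∀ i x → (x ∈ₗ ws i) ⇔ (x ∈ List.lookup es i × x ≢ v)) →
    (sub : ∀ i → Fin (length (ws i)) → RTree n) →
    (∀ i j → Σ[ C ∈ Hypergraph n ]
        (Component (stepGraph H v es i (ws i) (toℕ j)) (List.lookup (ws i) j) C
         × Weitz C (List.lookup (ws i) j) (sub i j))) →
    Weitz H v (assemble v (tabulate (λ i → tabulate (sub i))))

-- The independence polynomial Z(H; λ), evaluated in a commutative ring.

module _ (R : CommutativeRing 0ℓ 0ℓ) where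
  open CommutativeRing R using (Carrier; _*_; 0#; 1#) renaming (_+_ to _+ᴿ_)

  allSubsets : (n : ℕ) → List (Subset n)
  allSubsets zero = [] ∷ []
  allSubsets (suc n) = map (true ∷_) (allSubsets n) ++ map (false ∷_) (allSubsets n)

  monomial : ∀ {n} → Subset n → (Fin n → Carrier) → Carrier
  monomial [] lam = 1#
  monomial (b ∷ U) lam = (if b then lam zero else 1#) * monomial U (lam ∘ suc)

  independent : ∀ {n} → Hypergraph n → Subset n → Bool
  independent H U = does (U ⊆? verts H) ∧ not (any (λ e → does (e ⊆? U)) (edges H))

  Z : ∀ {n} → Hypergraph n → (Fin n → Carrier) → Carrier
  Z {n} H lam = foldr (λ U acc → (if independent H U then monomial U lam else 0#) +ᴿ acc)
                      0# (allSubsets n)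

  pow : Carrier → ℕ → Carrier
  pow x zero = 1#
  pow x (suc k) = x * pow x k

  prodZ : ∀ {n} → List (Hypergraph n × ℕ) → (Fin n → Carrier) → Carrier
  prodZ Hs lam = foldr (λ p acc → pow (Z (proj₁ p) lam) (proj₂ p) * acc) 1# Hs

{-# OPTIONS --safe #-}

-- Divisibility is strengthened so that the induction never divides: Z(T) and the part of Z(T) in
-- which r is occupied are the corresponding quantities of (H , v) times one and the same product of
-- partition functions of subhypergraphs.
--
-- Let H_i = (H − {e₁,…,e_i}) ⊖ v.  The ratio Z(H ⊖ v) / Z(H − v) telescopes into the factors
-- Z(H_{i-1}) / Z(H_i), and Z(H_i) − Z(H_{i-1}) is the part of Z(H_i) in which e_i ∖ v is occupied;
-- the ratio of that part to Z(H_i) telescopes once more over the vertices of e_i.  The recursion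
-- sees only components, so each step works on a vertex set that no hyperedge leaves.  When two
-- such sets K and L are merged, Z splits along K and along L, and the partition function of
-- K ∩ L, counted twice, is the new cofactor.

module Submission where

open import Defs
open import Level using (0ℓ)
open import Data.Nat.Base using (ℕ; zero; suc; _+_; _≤_)
open import Data.Nat.Properties using (≤-refl)
open import Data.Bool.Base using (true; false; if_then_else_; _∧_; not; T)
open import Data.Bool.ListAction using (any)
open import Data.Fin.Base using (Fin; zero; suc; toℕ; _↑ˡ_; _↑ʳ_)
open import Data.Fin.Properties using (splitAt-↑ˡ; splitAt-↑ʳ)
open import Data.Fin.Subset using (Subset; _∈_; _∉_; _⊆_; _∩_; _∪_; _─_; ⁅_⁆; ⋃; Nonempty) renaming (⊥ to ∅)
open import Data.Fin.Subset.Properties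
open import Data.Vec.Base as Vec using ([]; _∷_; here; there)
open import Data.List.Base using (List; []; _∷_; _++_; [_]; map; foldr; take; length; tabulate; lookup)
open import Data.List.Properties using (++-assoc; filter-all)
open import Data.List.Membership.Propositional using () renaming (_∈_ to _∈ₗ_; _∉_ to _∉ₗ_)
open import Data.List.Membership.Propositional.Properties using (∈-map⁺; ∈-map⁻; ∈-filter⁺; ∈-filter⁻; ∈-++⁺ˡ; ∈-++⁺ʳ; ∈-++⁻; ∈-lookup)
import Data.List.Membership.DecPropositional as DecMem
open import Data.List.Relation.Unary.Any using (here; there)
open import Data.List.Relation.Unary.All as All using (All; []; _∷_)
import Data.List.Relation.Unary.All.Properties as AllP
open import Data.List.Relation.Unary.AllPairs using (_∷_)
open import Data.List.Relation.Unary.Unique.Propositional using (Unique)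
open import Data.Product using (Σ-syntax; _×_; _,_; proj₁; proj₂; map₁)
open import Data.Sum.Base as Sum using (_⊎_; inj₁; inj₂; [_,_]′)
open import Data.Empty using (⊥; ⊥-elim)
open import Function.Base using (_∘_; id)
open import Function.Bundles using (_⇔_; mk⇔; Equivalence)
open import Relation.Nullary using (¬_; Dec; does; yes; no; ¬?; _×-dec_)
open import Relation.Nullary.Decidable using (does-⇔; T?; map′; decidable-stable)
open import Relation.Unary using (Decidable)
open import Relation.Binary.PropositionalEquality as ≡ using (_≡_; _≢_; refl; cong; subst)
open import Algebra.Bundles using (CommutativeRing)
import Algebra.Properties.Group as GroupProperties

open Equivalence using (to; from)

-- At given weights in a commutative ring, Z(H_i) may vanish or be a zero divisor, so a ratio is
-- carried as two products with a common cofactor. The occupied part has to be one of the two,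
-- because a subtree enters the next level only through its total and its occupied part. The
-- difference Z(H_i) - Z(H_{i-1}) then costs no more than a cancellation in the additive group.
--
-- A second obstacle is a hyperedge with a single vertex. It forbids that vertex, yet contracting
-- the vertex erases it, so an occupied vertex cannot be traded for a contraction there. Such cases
-- are treated apart; both sides are then zero.
--
-- The cofactors are chosen from the combinatorial data, before the ring and the weights. In a
-- polynomial ring, with the variables as weights, the identity is therefore divisibility of
-- polynomials.

Indep : ∀ {n} → List (Subset n) → Subset n → Set
Indep E U = ∀ e → e ∈ₗ E → ¬ (e ⊆ U)

indep? : ∀ {n} (E : List (Subset n)) → Decidable (Indep E)
indep? E U = map′ (λ a e e∈E → All.lookup a e∈E) (λ f → All.tabulate (λ {e} → f e))
  (All.all? (λ e → ¬? (e ⊆? U)) E)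

-- _⊆_ with its point explicit, so that it can be a component of a pair.
_≼_ : ∀ {n} → Subset n → Subset n → Set
A ≼ B = ∀ x → x ∈ A → x ∈ B

infix 4 _≼_

≼⇔⊆ : ∀ {n} {A B : Subset n} → A ≼ B ⇔ A ⊆ B
≼⇔⊆ = mk⇔ (λ s {x} → s x) (λ s x → s)

-- The required set `S` puts partition functions and their occupied parts on one footing: `∅` for Z
-- itself, `⁅ v ⁆` for an occupied root, `setOf ws` for a filled hyperedge.
Admissible : ∀ {n} → List (Subset n) → Subset n → Subset n → Set
Admissible E S U = Indep E U × S ≼ U

admissible? : ∀ {n} (E : List (Subset n)) (S : Subset n) → Decidable (Admissible E S)
admissible? E S U = indep? E U ×-dec map′ (from ≼⇔⊆) (to ≼⇔⊆) (S ⊆? U)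

≼-∷ : ∀ {n} {U A : Subset n} {c d} → (U ⊆ A) ⇔ ((c ∷ U) ⊆ (d ∷ A)) → (U ≼ A) ⇔ ((c ∷ U) ≼ (d ∷ A))
≼-∷ f = mk⇔ (λ s → from ≼⇔⊆ (to f (to ≼⇔⊆ s))) (λ s → from ≼⇔⊆ (from f (to ≼⇔⊆ s)))

⇔-×ˡ : ∀ {S B C P : Set} → S ⇔ (B × P) → C ⇔ B → S ⇔ (C × P)
⇔-×ˡ f g = mk⇔ (λ s → from g (proj₁ (to f s)) , proj₂ (to f s)) (λ z → from f (to g (proj₁ z) , proj₂ z))

-- Vertex sets, contraction and independence

module _ {n : ℕ} {x : Fin n} where

  ∈∩⁺ : ∀ {p q} → x ∈ p → x ∈ q → x ∈ p ∩ q
  ∈∩⁺ a b = x∈p∩q⁺ (a , b)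

  ∈∩⁻ˡ : ∀ p q → x ∈ p ∩ q → x ∈ p
  ∈∩⁻ˡ p q a = proj₁ (x∈p∩q⁻ p q a)

  ∈∩⁻ʳ : ∀ p q → x ∈ p ∩ q → x ∈ q
  ∈∩⁻ʳ p q a = proj₂ (x∈p∩q⁻ p q a)

  ∈∪⁺ˡ : ∀ {p q} → x ∈ p → x ∈ p ∪ q
  ∈∪⁺ˡ a = x∈p∪q⁺ (inj₁ a)

  ∈∪⁺ʳ : ∀ {p q} → x ∈ q → x ∈ p ∪ q
  ∈∪⁺ʳ a = x∈p∪q⁺ (inj₂ a)

∈─⁻ˡ : ∀ {n} {x : Fin n} p q → x ∈ p ─ q → x ∈ p
∈─⁻ˡ p q = p─q⊆p p q

∈─⁻ʳ : ∀ {n} {x : Fin n} p q → x ∈ p ─ q → x ∉ q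
∈─⁻ʳ (_ ∷ p) (true ∷ q) () here
∈─⁻ʳ (_ ∷ p) (_ ∷ q) (there a) (there b) = ∈─⁻ʳ p q a b

∈─⁺ : ∀ {n} {x : Fin n} {p q} → x ∈ p → x ∉ q → x ∈ p ─ q
∈─⁺ = x∈p∧x∉q⇒x∈p─q

≼-antisym : ∀ {n} {A B : Subset n} → A ≼ B → B ≼ A → A ≡ B
≼-antisym s t = ⊆-antisym (s _) (t _)

-- `contr` transforms hyperedges without regard to the vertex set, so for `E = edges G` this is
-- definitionally the hyperedge list of `contr G S`.
contrEdges : ∀ {n} → List (Subset n) → Subset n → List (Subset n)
contrEdges E S = edges (contr (hypergraph ∅ E) S)

module _ {n} (E : List (Subset n)) (S : Subset n) where

  ∈-contr⁻ : ∀ {e} → e ∈ₗ contrEdges E S → Σ[ f ∈ Subset n ] f ∈ₗ E × ¬ (f ⊆ S) × e ≡ f ─ S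
  ∈-contr⁻ e∈ with ∈-map⁻ (_─ S) e∈
  ... | f , f∈ , eq with ∈-filter⁻ (λ e → ¬? (e ⊆? S)) f∈
  ... | f∈E , f⊈S = f , f∈E , f⊈S , eq

  ∈-contr⁺ : ∀ {f} → f ∈ₗ E → ¬ (f ⊆ S) → (f ─ S) ∈ₗ contrEdges E S
  ∈-contr⁺ f∈E f⊈S = ∈-map⁺ (_─ S) (∈-filter⁺ (λ e → ¬? (e ⊆? S)) f∈E f⊈S)

-- A union of components, said without reachability. Components found at different stages of the
-- recursion overlap; their unions need not be components, but they are still closed.
Closed : ∀ {n} → List (Subset n) → Subset n → Set
Closed E K = ∀ e → e ∈ₗ E → ∀ x → x ∈ e → x ∈ K → e ≼ K

Closed-contr : ∀ {n} {E : List (Subset n)} {S K} → Closed E K → Closed (contrEdges E S) K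
Closed-contr {E = E} {S} cl e e∈ x x∈e x∈K y y∈e with ∈-contr⁻ E S e∈
... | f , f∈E , _ , refl = cl f f∈E x (∈─⁻ˡ f S x∈e) x∈K y (∈─⁻ˡ f S y∈e)

indep-⊆ : ∀ {n} {E : List (Subset n)} {U V} → V ≼ U → Indep E U → Indep E V
indep-⊆ s i e e∈ e⊆ = i e e∈ (λ x∈ → s _ (e⊆ x∈))

indep-split : ∀ {n} {E : List (Subset n)} {K U} → Closed E K → Indep E (U ∩ K) → Indep E (U ─ K) → Indep E U
indep-split {K = K} {U} cl i j e e∈ e⊆ with nonempty? (e ∩ K)
... | yes (x , x∈) = i e e∈ (λ y∈ → ∈∩⁺ (e⊆ y∈) (cl e e∈ x (∈∩⁻ˡ e K x∈) (∈∩⁻ʳ e K x∈) _ y∈))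
... | no e∩K=∅ = j e e∈ (λ y∈ → ∈─⁺ (e⊆ y∈) (λ y∈K → e∩K=∅ (_ , ∈∩⁺ y∈ y∈K)))

indep-contr⁺ : ∀ {n} {E : List (Subset n)} {U S} → Indep E (U ∪ S) → Indep (contrEdges E S) U
indep-contr⁺ {E = E} {U} {S} i e e∈ e⊆ with ∈-contr⁻ E S e∈
... | f , f∈E , _ , refl = i f f∈E f⊆
  where
  f⊆ : f ⊆ U ∪ S
  f⊆ {y} y∈ with y ∈? S
  ... | yes y∈S = ∈∪⁺ʳ y∈S
  ... | no y∉S = ∈∪⁺ˡ (e⊆ (∈─⁺ y∈ y∉S))

-- Contraction discards the hyperedges inside `S`, so a violation there would go unseen;
-- independence of `S` excludes it.
indep-contr⁻ : ∀ {n} {E : List (Subset n)} {U S} → Indep E S → Indep (contrEdges E S) U → Indep E (U ∪ S)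
indep-contr⁻ {E = E} {U} {S} s i f f∈ f⊆ = i (f ─ S) (∈-contr⁺ E S f∈ (s f f∈)) sub
  where
  sub : f ─ S ⊆ U
  sub {y} y∈ with x∈p∪q⁻ U S (f⊆ (∈─⁻ˡ f S y∈))
  ... | inj₁ y∈U = y∈U
  ... | inj₂ y∈S = ⊥-elim (∈─⁻ʳ f S y∈ y∈S)

module _ {n} (G : Hypergraph n) where

  -- Written as in `Component`, so that matching on `refl` turns a component into an induced
  -- hypergraph, and `sub-delV` makes it a subhypergraph.
  induced : Subset n → Hypergraph n
  induced K = delV G (verts G ─ K)

  module _ {K : Subset n} (K≼V : K ≼ verts G) where

    verts-induced : verts (induced K) ≡ K
    verts-induced = ≼-antisym
      (λ x x∈ → decidable-stable (x ∈? K) (λ x∉ → ∈─⁻ʳ (verts G) (verts G ─ K) x∈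
        (∈─⁺ (∈─⁻ˡ (verts G) (verts G ─ K) x∈) x∉)))
      (λ x x∈K → ∈─⁺ (K≼V x x∈K) (λ x∈ → ∈─⁻ʳ (verts G) K x∈ x∈K))

    ∈-induced⁺ : ∀ {e} → e ∈ₗ edges G → e ≼ K → e ∈ₗ edges (induced K)
    ∈-induced⁺ {e} e∈ e≼K = ∈-filter⁺ (λ e → ¬? (nonempty? (e ∩ (verts G ─ K)))) e∈
      (λ (x , x∈) → ∈─⁻ʳ (verts G) K (∈∩⁻ʳ e _ x∈) (e≼K x (∈∩⁻ˡ e _ x∈)))

    ∈-induced⁻ : ∀ {e} → e ∈ₗ edges (induced K) → e ∈ₗ edges G × (∀ x → x ∈ e → x ∈ verts G → x ∈ K)
    ∈-induced⁻ {e} e∈ with ∈-filter⁻ (λ e → ¬? (nonempty? (e ∩ (verts G ─ K)))) e∈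
    ... | e∈G , empty = e∈G , λ x x∈e x∈V →
      decidable-stable (x ∈? K) (λ x∉K → empty (x , ∈∩⁺ x∈e (∈─⁺ x∈V x∉K)))

-- Hyperedges and marks of a disjoint union

Covers : ∀ {n} → List (Subset n) → Subset n → Set
Covers ms U = ∀ e → e ∈ₗ ms → e ≼ U

covers? : ∀ {n} (ms : List (Subset n)) → Decidable (Covers ms)
covers? ms U = map′ (λ a e e∈ x → All.lookup a e∈ {x}) (λ f → All.tabulate (λ {e} e∈ {x} → f e e∈ x))
  (All.all? (_⊆? U) ms)

liftL-≼⁺ : ∀ {m k} {e U : Subset m} (V : Subset k) → e ≼ U → liftL k e ≼ (U Vec.++ V)
liftL-≼⁺ {e = []} {[]} V s x x∈ = ⊥-elim (∉⊥ x∈)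
liftL-≼⁺ {e = true ∷ e} {u ∷ U} V s zero here with s zero here
... | here = here
liftL-≼⁺ {e = b ∷ e} {u ∷ U} V s (suc x) (there x∈) =
  there (liftL-≼⁺ V (λ y y∈ → drop-there (s (suc y) (there y∈))) x x∈)

liftL-≼⁻ : ∀ {m k} {e U : Subset m} (V : Subset k) → liftL k e ≼ (U Vec.++ V) → e ≼ U
liftL-≼⁻ {e = true ∷ e} {u ∷ U} V s zero here with s zero here
... | here = here
liftL-≼⁻ {e = b ∷ e} {u ∷ U} V s (suc x) (there x∈) =
  there (liftL-≼⁻ V (λ y y∈ → drop-there (s (suc y) (there y∈))) x x∈)

liftR-≼⁺ : ∀ {m k} {e V : Subset k} (U : Subset m) → e ≼ V → liftR m e ≼ (U Vec.++ V)
liftR-≼⁺ [] s x x∈ = s x x∈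
liftR-≼⁺ (u ∷ U) s (suc x) (there x∈) = there (liftR-≼⁺ U s x x∈)

liftR-≼⁻ : ∀ {m k} {e V : Subset k} (U : Subset m) → liftR m e ≼ (U Vec.++ V) → e ≼ V
liftR-≼⁻ [] s x x∈ = s x x∈
liftR-≼⁻ (u ∷ U) s x x∈ = liftR-≼⁻ U (λ y y∈ → drop-there (s (suc y) (there y∈))) x x∈

module _ {m k} (E : List (Subset m)) (E′ : List (Subset k)) (U : Subset m) (V : Subset k) where

  lifted : List (Subset (m + k))
  lifted = map (liftL k) E ++ map (liftR m) E′

  ∈-lifted⁻ : ∀ {e} → e ∈ₗ lifted → (Σ[ f ∈ Subset m ] f ∈ₗ E × e ≡ liftL k f) ⊎ (Σ[ f ∈ Subset k ] f ∈ₗ E′ × e ≡ liftR m f)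
  ∈-lifted⁻ e∈ with ∈-++⁻ (map (liftL k) E) e∈
  ... | inj₁ a = inj₁ (∈-map⁻ (liftL k) a)
  ... | inj₂ b = inj₂ (∈-map⁻ (liftR m) b)

  ∈-lifted⁺ˡ : ∀ {e} → e ∈ₗ E → liftL k e ∈ₗ lifted
  ∈-lifted⁺ˡ e∈ = ∈-++⁺ˡ (∈-map⁺ (liftL k) e∈)

  ∈-lifted⁺ʳ : ∀ {e} → e ∈ₗ E′ → liftR m e ∈ₗ lifted
  ∈-lifted⁺ʳ e∈ = ∈-++⁺ʳ (map (liftL k) E) (∈-map⁺ (liftR m) e∈)

  indep-lifted : Indep lifted (U Vec.++ V) ⇔ (Indep E U × Indep E′ V)
  indep-lifted = mk⇔
    (λ i → (λ e e∈ e⊆ → i (liftL k e) (∈-lifted⁺ˡ e∈) (liftL-≼⁺ V (λ _ → e⊆) _)) ,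
           (λ e e∈ e⊆ → i (liftR m e) (∈-lifted⁺ʳ e∈) (liftR-≼⁺ U (λ _ → e⊆) _)))
    (λ (i , j) e e∈ → go i j (∈-lifted⁻ e∈))
    where
    go : Indep E U → Indep E′ V → ∀ {e} →
      (Σ[ f ∈ Subset m ] f ∈ₗ E × e ≡ liftL k f) ⊎ (Σ[ f ∈ Subset k ] f ∈ₗ E′ × e ≡ liftR m f) → ¬ (e ⊆ (U Vec.++ V))
    go i j (inj₁ (f , f∈ , refl)) e⊆ = i f f∈ (liftL-≼⁻ V (λ _ → e⊆) _)
    go i j (inj₂ (f , f∈ , refl)) e⊆ = j f f∈ (liftR-≼⁻ U (λ _ → e⊆) _)

  covers-lifted : Covers lifted (U Vec.++ V) ⇔ (Covers E U × Covers E′ V)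
  covers-lifted = mk⇔
    (λ c → (λ e e∈ → liftL-≼⁻ V (c (liftL k e) (∈-lifted⁺ˡ e∈))) ,
           (λ e e∈ → liftR-≼⁻ U (c (liftR m e) (∈-lifted⁺ʳ e∈))))
    (λ (c , d) e e∈ → go c d (∈-lifted⁻ e∈))
    where
    go : Covers E U → Covers E′ V → ∀ {e} →
      (Σ[ f ∈ Subset m ] f ∈ₗ E × e ≡ liftL k f) ⊎ (Σ[ f ∈ Subset k ] f ∈ₗ E′ × e ≡ liftR m f) → e ≼ (U Vec.++ V)
    go c d (inj₁ (f , f∈ , refl)) = liftL-≼⁺ V (c f f∈)
    go c d (inj₂ (f , f∈ , refl)) = liftR-≼⁺ U (d f f∈)

-- A group replaces the root singletons of its trees by their union; filling that one mark means
-- occupying every root.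
⋃-covers : ∀ {n} (ms : List (Subset n)) {U} → ⋃ ms ≼ U ⇔ Covers ms U
⋃-covers ms = mk⇔ (λ s e e∈ x x∈ → s x (into ms e∈ x∈)) (λ c → out ms c)
  where
  into : ∀ ms {e x} → e ∈ₗ ms → x ∈ e → x ∈ ⋃ ms
  into (m ∷ ms) (here refl) x∈ = ∈∪⁺ˡ x∈
  into (m ∷ ms) (there e∈) x∈ = ∈∪⁺ʳ (into ms e∈ x∈)
  out : ∀ ms {U} → Covers ms U → ⋃ ms ≼ U
  out [] c x x∈ = ⊥-elim (∉⊥ x∈)
  out (m ∷ ms) c x x∈ with x∈p∪q⁻ m (⋃ ms) x∈
  ... | inj₁ a = c m (here refl) x a
  ... | inj₂ b = out ms (λ e e∈ → c e (there e∈)) x b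

×-⇔ : ∀ {A B C D E F : Set} → A ⇔ (B × C) → D ⇔ (E × F) → (A × D) ⇔ ((B × E) × (C × F))
×-⇔ f g = mk⇔ (λ (a , d) → (proj₁ (to f a) , proj₁ (to g d)) , (proj₂ (to f a) , proj₂ (to g d)))
               (λ ((b , e) , (c , h)) → from f (b , c) , from g (e , h))

-- Weighted sums over subsets

module Sums (R : CommutativeRing 0ℓ 0ℓ) where
  open CommutativeRing R renaming (_+_ to _+ᴿ_; refl to ≈-refl; sym to ≈-sym; trans to ≈-trans) hiding (zero)
  open import Relation.Binary.Reasoning.Setoid setoid
  open import Algebra.Solver.Ring.NaturalCoefficients.Default commutativeSemiring using (solve; _:=_; _:+_; _:*_)

  -- The sum of the monomials of all U ⊆ A with P U.
  W : ∀ {n} {P : Subset n → Set} → (Fin n → Carrier) → Subset n → Decidable P → Carrier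
  W lam [] P? = if does (P? []) then 1# else 0#
  W lam (true ∷ A) P? = lam zero * W (lam ∘ suc) A (P? ∘ (true ∷_)) +ᴿ W (lam ∘ suc) A (P? ∘ (false ∷_))
  W lam (false ∷ A) P? = W (lam ∘ suc) A (P? ∘ (false ∷_))

  W-cong : ∀ {n} {P Q : Subset n → Set} (lam : Fin n → Carrier) (A : Subset n) (P? : Decidable P) (Q? : Decidable Q) →
    (∀ U → U ⊆ A → P U ⇔ Q U) → W lam A P? ≈ W lam A Q?
  W-cong lam [] P? Q? eq = reflexive (cong (if_then 1# else 0#) (does-⇔ (eq [] (λ ())) (P? []) (Q? [])))
  W-cong lam (true ∷ A) P? Q? eq = +-cong
    (*-congˡ (W-cong _ A _ _ (λ U s → eq (true ∷ U) (s⊆s s))))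
    (W-cong _ A _ _ (λ U s → eq (false ∷ U) (out⊆ s)))
  W-cong lam (false ∷ A) P? Q? eq = W-cong _ A _ _ (λ U s → eq (false ∷ U) (out⊆ s))

  W-cong-weights : ∀ {n} {P : Subset n → Set} {lam mu : Fin n → Carrier} (A : Subset n) (P? : Decidable P) →
    (∀ i → lam i ≈ mu i) → W lam A P? ≈ W mu A P?
  W-cong-weights [] P? eq = ≈-refl
  W-cong-weights (true ∷ A) P? eq = +-cong (*-cong (eq zero) (W-cong-weights A _ (eq ∘ suc))) (W-cong-weights A _ (eq ∘ suc))
  W-cong-weights (false ∷ A) P? eq = W-cong-weights A _ (eq ∘ suc)

  W-none : ∀ {n} {P : Subset n → Set} (lam : Fin n → Carrier) (A : Subset n) (P? : Decidable P) →
    (∀ U → U ⊆ A → ¬ P U) → W lam A P? ≈ 0#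
  W-none lam [] P? none with P? []
  ... | yes p = ⊥-elim (none [] (λ ()) p)
  ... | no _ = ≈-refl
  W-none lam (true ∷ A) P? none = begin
    lam zero * W _ A (P? ∘ (true ∷_)) +ᴿ W _ A (P? ∘ (false ∷_))
      ≈⟨ +-cong (*-congˡ (W-none _ A _ (λ U s → none _ (s⊆s s)))) (W-none _ A _ (λ U s → none _ (out⊆ s))) ⟩
    lam zero * 0# +ᴿ 0# ≈⟨ ≈-trans (+-identityʳ _) (zeroʳ _) ⟩
    0# ∎
  W-none lam (false ∷ A) P? none = W-none _ A _ (λ U s → none _ (out⊆ s))

  W-∅ : ∀ {n} {P : Subset n → Set} (lam : Fin n → Carrier) (P? : Decidable P) → P ∅ → W lam ∅ P? ≈ 1#
  W-∅ {zero} lam P? p with P? []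
  ... | yes _ = ≈-refl
  ... | no ¬p = ⊥-elim (¬p p)
  W-∅ {suc n} lam P? p = W-∅ (lam ∘ suc) _ p

  W-partition : ∀ {n} {P Q S : Subset n → Set} (lam : Fin n → Carrier) (A : Subset n)
    (P? : Decidable P) (Q? : Decidable Q) (S? : Decidable S) →
    (∀ U → S U → (P U × ¬ Q U)) → (∀ U → P U → ¬ Q U → S U) → (∀ U → Q U → P U) →
    W lam A P? ≈ W lam A S? +ᴿ W lam A Q?
  W-partition lam [] P? Q? S? f g h with P? [] | Q? [] | S? []
  ... | yes p | yes q | yes s = ⊥-elim (proj₂ (f _ s) q)
  ... | yes p | yes q | no s = ≈-sym (+-identityˡ _)
  ... | yes p | no q | yes s = ≈-sym (+-identityʳ _)
  ... | yes p | no q | no s = ⊥-elim (s (g _ p q))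
  ... | no p | yes q | _ = ⊥-elim (p (h _ q))
  ... | no p | no q | yes s = ⊥-elim (p (proj₁ (f _ s)))
  ... | no p | no q | no s = ≈-sym (+-identityʳ _)
  W-partition lam (true ∷ A) P? Q? S? f g h = ≈-trans
    (+-cong (*-congˡ (W-partition _ A _ _ _ (f ∘ (true ∷_)) (g ∘ (true ∷_)) (h ∘ (true ∷_))))
            (W-partition _ A _ _ _ (f ∘ (false ∷_)) (g ∘ (false ∷_)) (h ∘ (false ∷_))))
    (solve 5 (λ l a b c d → (l :* (a :+ b) :+ (c :+ d)) := ((l :* a :+ c) :+ (l :* b :+ d))) ≈-refl
      (lam zero) _ _ _ _)
  W-partition lam (false ∷ A) P? Q? S? f g h =
    W-partition _ A _ _ _ (f ∘ (false ∷_)) (g ∘ (false ∷_)) (h ∘ (false ∷_))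

  if-× : ∀ {A B C : Set} (a? : Dec A) (b? : Dec B) (c? : Dec C) → A ⇔ (B × C) →
    (if does a? then 1# else 0#) ≈ (if does b? then 1# else 0#) * (if does c? then 1# else 0#)
  if-× a? b? c? eq = ≈-trans (reflexive (cong (if_then 1# else 0#) (does-⇔ eq a? (b? ×-dec c?)))) (go (does b?) (does c?))
    where
    go : ∀ x y → (if x ∧ y then 1# else 0#) ≈ (if x then 1# else 0#) * (if y then 1# else 0#)
    go true y = ≈-sym (*-identityˡ _)
    go false y = ≈-sym (zeroˡ _)

  W-split : ∀ {n} {P P₁ P₂ : Subset n → Set} (lam : Fin n → Carrier) (C D : Subset n)
    (P? : Decidable P) (P₁? : Decidable P₁) (P₂? : Decidable P₂) →
    (∀ U → U ⊆ C → P U ⇔ (P₁ (U ∩ D) × P₂ (U ─ D))) →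
    W lam C P? ≈ W lam (C ∩ D) P₁? * W lam (C ─ D) P₂?
  W-split lam [] [] P? P₁? P₂? eq = if-× (P? []) (P₁? []) (P₂? []) (eq [] (λ ()))
  W-split lam (true ∷ C) (true ∷ D) P? P₁? P₂? eq = ≈-trans
    (+-cong (*-congˡ (W-split _ C D _ _ _ (λ U s → eq (true ∷ U) (s⊆s s))))
            (W-split _ C D _ _ _ (λ U s → eq (false ∷ U) (out⊆ s))))
    (solve 4 (λ l a b c → (l :* (a :* c) :+ b :* c) := ((l :* a :+ b) :* c)) ≈-refl (lam zero) _ _ _)
  W-split lam (true ∷ C) (false ∷ D) P? P₁? P₂? eq = ≈-trans
    (+-cong (*-congˡ (W-split _ C D _ _ _ (λ U s → eq (true ∷ U) (s⊆s s))))
            (W-split _ C D _ _ _ (λ U s → eq (false ∷ U) (out⊆ s))))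
    (solve 4 (λ l a b c → (l :* (a :* b) :+ a :* c) := (a :* (l :* b :+ c))) ≈-refl (lam zero) _ _ _)
  W-split lam (false ∷ C) (true ∷ D) P? P₁? P₂? eq = W-split _ C D _ _ _ (λ U s → eq (false ∷ U) (out⊆ s))
  W-split lam (false ∷ C) (false ∷ D) P? P₁? P₂? eq = W-split _ C D _ _ _ (λ U s → eq (false ∷ U) (out⊆ s))

  W-expand : ∀ {n} {P : Subset n → Set} (lam : Fin n → Carrier) (C : Subset n) (x : Fin n) (P? : Decidable P) → x ∈ C →
    W lam C P? ≈ lam x * W lam (C ─ ⁅ x ⁆) (λ U → P? (U ∪ ⁅ x ⁆)) +ᴿ W lam (C ─ ⁅ x ⁆) P?
  W-expand {suc n} {P} lam (true ∷ C) zero P? here =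
    subst (λ B → W lam (true ∷ C) P? ≈ lam zero * W (lam ∘ suc) B (λ U → P? (true ∷ (U ∪ ∅))) +ᴿ W (lam ∘ suc) B (P? ∘ (false ∷_)))
      (≡.sym (p─⊥≡p C))
      (+-congʳ (*-congˡ (W-cong (lam ∘ suc) C _ _ (λ U _ → ≡⇒⇔ (cong (λ V → P (true ∷ V)) (≡.sym (∪-identityʳ U)))))))
    where
    ≡⇒⇔ : ∀ {A B : Set} → A ≡ B → A ⇔ B
    ≡⇒⇔ refl = mk⇔ (λ a → a) (λ a → a)
  W-expand lam (true ∷ C) (suc x) P? (there x∈C) = ≈-trans
    (+-cong (*-congˡ (W-expand _ C x _ x∈C)) (W-expand _ C x _ x∈C))
    (solve 6 (λ l m a b c d → (l :* (m :* a :+ b) :+ (m :* c :+ d)) := (m :* (l :* a :+ c) :+ (l :* b :+ d))) ≈-refl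
      (lam zero) (lam (suc x)) _ _ _ _)
  W-expand lam (false ∷ C) (suc x) P? (there x∈C) = W-expand _ C x _ x∈C

  W-++ : ∀ {m k} {P : Subset (m + k) → Set} {P₁ : Subset m → Set} {P₂ : Subset k → Set} (lam : Fin (m + k) → Carrier)
    (A : Subset m) (B : Subset k) (P? : Decidable P) (P₁? : Decidable P₁) (P₂? : Decidable P₂) →
    (∀ U V → P (U Vec.++ V) ⇔ (P₁ U × P₂ V)) →
    W lam (A Vec.++ B) P? ≈ W (λ i → lam (i ↑ˡ k)) A P₁? * W (λ i → lam (m ↑ʳ i)) B P₂?
  W-++ lam [] B P? P₁? P₂? eq with P₁? []
  ... | yes p = ≈-trans (W-cong lam B P? P₂? (λ V _ → mk⇔ (λ q → proj₂ (to (eq [] V) q)) (λ q → from (eq [] V) (p , q))))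
                  (≈-sym (*-identityˡ _))
  ... | no ¬p = ≈-trans (W-none lam B P? (λ V _ q → ¬p (proj₁ (to (eq [] V) q)))) (≈-sym (zeroˡ _))
  W-++ lam (true ∷ A) B P? P₁? P₂? eq = ≈-trans
    (+-cong (*-congˡ (W-++ _ A B _ _ _ (eq ∘ (true ∷_)))) (W-++ _ A B _ _ _ (eq ∘ (false ∷_))))
    (solve 4 (λ l a b c → (l :* (a :* c) :+ b :* c) := ((l :* a :+ b) :* c)) ≈-refl (lam zero) _ _ _)
  W-++ lam (false ∷ A) B P? P₁? P₂? eq = W-++ _ A B _ _ _ (eq ∘ (false ∷_))

  -- Hyperedges and domain are separate parameters: a hyperedge that leaves `A` is contained in no
  -- `U ⊆ A`, so restricting to a smaller vertex set requires no change of `E`.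
  Ξ : ∀ {n} → (Fin n → Carrier) → List (Subset n) → Subset n → Subset n → Carrier
  Ξ lam E A S = W lam A (admissible? E S)

  sumOver : ∀ {n} → (Subset n → Carrier) → List (Subset n) → Carrier
  sumOver f = foldr (λ U acc → f U +ᴿ acc) 0#

  sumOver-++ : ∀ {n} (f : Subset n → Carrier) xs ys → sumOver f (xs ++ ys) ≈ sumOver f xs +ᴿ sumOver f ys
  sumOver-++ f [] ys = ≈-sym (+-identityˡ _)
  sumOver-++ f (x ∷ xs) ys = ≈-trans (+-congˡ (sumOver-++ f xs ys)) (≈-sym (+-assoc _ _ _))

  sumOver-map : ∀ {m n} {f : Subset n → Carrier} {g : Subset m → Carrier} {h : Subset m → Subset n} (c : Carrier) xs →
    (∀ U → f (h U) ≈ c * g U) → sumOver f (map h xs) ≈ c * sumOver g xs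
  sumOver-map c [] eq = ≈-sym (zeroʳ c)
  sumOver-map c (x ∷ xs) eq = ≈-trans (+-cong (eq x) (sumOver-map c xs eq)) (≈-sym (distribˡ c _ _))

  if-* : ∀ b {c x} → (if b then c * x else 0#) ≈ c * (if b then x else 0#)
  if-* true = ≈-refl
  if-* false = ≈-sym (zeroʳ _)

  -- Z runs over all subsets of `Fin n` and tests each for lying in the vertex set; here that test
  -- is absorbed into the recursion on `A`.
  sum≈W : ∀ {n} {P S : Subset n → Set} (lam : Fin n → Carrier) (A : Subset n) (P? : Decidable P) (S? : Decidable S) →
    (∀ U → S U ⇔ (U ≼ A × P U)) →
    sumOver (λ U → if does (S? U) then monomial R U lam else 0#) (allSubsets R n) ≈ W lam A P?
  sum≈W lam [] P? S? eq = ≈-trans (+-identityʳ _)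
    (reflexive (cong (if_then 1# else 0#) (does-⇔ (mk⇔ (λ s → proj₂ (to (eq []) s)) (λ p → from (eq []) ((λ _ ()) , p))) (S? []) (P? []))))
  sum≈W {suc n} {P} {S} lam (b ∷ A) P? S? eq = ≈-trans (sumOver-++ _ (map (true ∷_) (allSubsets R n)) _) (go b eq)
    where
    half : ∀ c → sumOver (λ U → if does (S? U) then monomial R U lam else 0#) (map (c ∷_) (allSubsets R n)) ≈
      (if c then lam zero else 1#) * sumOver (λ U → if does (S? (c ∷ U)) then monomial R U (lam ∘ suc) else 0#) (allSubsets R n)
    half c = sumOver-map _ (allSubsets R n) (λ U → if-* (does (S? (c ∷ U))))
    out : ∀ {d} → (∀ U → S U ⇔ (U ≼ (d ∷ A) × P U)) → ∀ U → S (false ∷ U) ⇔ (U ≼ A × P (false ∷ U))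
    out eq U = ⇔-×ˡ (eq (false ∷ U)) (≼-∷ (out⊆-⇔))
    go : ∀ d → (∀ U → S U ⇔ (U ≼ (d ∷ A) × P U)) → _ ≈ W lam (d ∷ A) P?
    go true eq = +-cong
      (≈-trans (half true) (*-congˡ (sum≈W (lam ∘ suc) A (P? ∘ (true ∷_)) (S? ∘ (true ∷_))
        (λ U → ⇔-×ˡ (eq (true ∷ U)) (≼-∷ (in⊆in-⇔))))))
      (≈-trans (half false) (≈-trans (*-identityˡ _) (sum≈W (lam ∘ suc) A (P? ∘ (false ∷_)) (S? ∘ (false ∷_)) (out eq))))
    go false eq = ≈-trans (+-cong
      (≈-trans (half true) (*-congˡ (≈-trans
        -- With `zero` outside the domain, no set containing it passes the test, so this half is the
        -- sum over the empty predicate.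
        (sum≈W {P = λ _ → ⊥} (lam ∘ suc) A (λ _ → no (λ ())) (S? ∘ (true ∷_))
          (λ U → mk⇔ (λ s → ⊥-elim (zero∉ (proj₁ (to (eq _) s) zero here))) (λ ())))
        (W-none (lam ∘ suc) A (λ _ → no (λ ())) (λ _ _ ())))))
      (≈-trans (half false) (≈-trans (*-identityˡ _) (sum≈W (lam ∘ suc) A (P? ∘ (false ∷_)) (S? ∘ (false ∷_)) (out eq)))))
      (≈-trans (+-congʳ (zeroʳ _)) (+-identityˡ _))
      where
      zero∉ : ∀ {m} {B : Subset m} → ¬ (zero ∈ (false ∷ B))
      zero∉ ()

  T-independent : ∀ {n} (H : Hypergraph n) U → T (independent R H U) ⇔ (U ≼ verts H × Indep (edges H) U)
  T-independent H U with U ⊆? verts H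
  ... | no ¬s = mk⇔ (λ ()) (λ { (s , _) → ⊥-elim (¬s (s _)) })
  ... | yes s = mk⇔ (λ t → (λ _ → s) , sound (edges H) t) (λ (_ , i) → complete (edges H) i)
    where
    open import Data.List.Relation.Unary.Any using (here; there)
    sound : ∀ E → T (not (any (λ e → does (e ⊆? U)) E)) → Indep E U
    sound (f ∷ E) t e e∈ e⊆ with f ⊆? U
    sound (f ∷ E) t e (here refl) e⊆ | no ¬f = ¬f e⊆
    sound (f ∷ E) t e (there e∈) e⊆ | no ¬f = sound E t e e∈ e⊆
    complete : ∀ E → Indep E U → T (not (any (λ e → does (e ⊆? U)) E))
    complete [] i = _
    complete (f ∷ E) i with f ⊆? U
    ... | yes f⊆ = i f (here refl) f⊆
    ... | no _ = complete E (λ e e∈ → i e (there e∈))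

  Z≈W : ∀ {n} (H : Hypergraph n) lam → Z R H lam ≈ W lam (verts H) (indep? (edges H))
  Z≈W H lam = sum≈W lam (verts H) (indep? (edges H)) (λ U → T? (independent R H U)) (T-independent H)

  Ξ-∅ : ∀ {n} (lam : Fin n → Carrier) E A → Ξ lam E A ∅ ≈ W lam A (indep? E)
  Ξ-∅ lam E A = W-cong lam A (admissible? E ∅) (indep? E) (λ U _ → mk⇔ proj₁ (λ i → i , λ _ → ⊥⊆))

  Z≈Ξ : ∀ {n} (H : Hypergraph n) lam → Z R H lam ≈ Ξ lam (edges H) (verts H) ∅
  Z≈Ξ H lam = ≈-trans (Z≈W H lam) (≈-sym (Ξ-∅ lam (edges H) (verts H)))

  -- Partition functions under splitting, contraction and restriction

  module _ {n} (lam : Fin n → Carrier) where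

    Ξ-domain : ∀ E {A A′} S → A ≼ A′ → A′ ≼ A → Ξ lam E A S ≈ Ξ lam E A′ S
    Ξ-domain E S s t = reflexive (cong (λ A → Ξ lam E A S) (≼-antisym s t))

    Ξ-required : ∀ E A {S S′} → S ≼ S′ → S′ ≼ S → Ξ lam E A S ≈ Ξ lam E A S′
    Ξ-required E A s t = reflexive (cong (Ξ lam E A) (≼-antisym s t))

    Ξ-edges : ∀ E E′ A S → (∀ U → U ≼ A → Indep E U → Indep E′ U) → (∀ U → U ≼ A → Indep E′ U → Indep E U) →
      Ξ lam E A S ≈ Ξ lam E′ A S
    Ξ-edges E E′ A S f g = W-cong lam A (admissible? E S) (admissible? E′ S)
      (λ U s → mk⇔ (λ (i , t) → f U (λ _ → s) i , t) (λ (i , t) → g U (λ _ → s) i , t))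

    Ξ-∅∅ : ∀ E → (∀ e → e ∈ₗ E → Nonempty e) → Ξ lam E ∅ ∅ ≈ 1#
    Ξ-∅∅ E ne = W-∅ lam (admissible? E ∅) ((λ e e∈ e⊆ → ∉⊥ (e⊆ (proj₂ (ne e e∈)))) , λ _ a → a)

    -- By closedness every hyperedge lies inside `K` or misses it, so independence can be tested on
    -- the two sides separately, and so can containing `S`.
    Ξ-split : ∀ E {K} X S → Closed E K → Ξ lam E X S ≈ Ξ lam E (X ∩ K) (S ∩ K) * Ξ lam E (X ─ K) (S ─ K)
    Ξ-split E {K} X S cl = W-split lam X K (admissible? E S) (admissible? E (S ∩ K)) (admissible? E (S ─ K))
      (λ U _ → mk⇔
        (λ (i , s) →
          (indep-⊆ (λ x → ∈∩⁻ˡ U K) i , λ x x∈ → ∈∩⁺ (s x (∈∩⁻ˡ S K x∈)) (∈∩⁻ʳ S K x∈)) ,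
          (indep-⊆ (λ x → ∈─⁻ˡ U K) i , λ x x∈ → ∈─⁺ (s x (∈─⁻ˡ S K x∈)) (∈─⁻ʳ S K x∈)))
        (λ ((i , s) , (j , t)) → indep-split cl i j , λ x x∈ → combine U s t x x∈))
      where
      combine : ∀ U → S ∩ K ≼ U ∩ K → S ─ K ≼ U ─ K → S ≼ U
      combine U s t x x∈ with x ∈? K
      ... | yes x∈K = ∈∩⁻ˡ U K (s x (∈∩⁺ x∈ x∈K))
      ... | no x∉K = ∈─⁻ˡ U K (t x (∈─⁺ x∈ x∉K))

    -- Only the half of the expansion at `w` that occupies it survives. There independence of
    -- `U ∪ ⁅ w ⁆` becomes independence of `U` in the contraction, which would have lost a hyperedge
    -- `⁅ w ⁆`.
    Ξ-contr : ∀ E A S {w} → w ∈ A → w ∉ S → Indep E ⁅ w ⁆ →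
      Ξ lam E A (⁅ w ⁆ ∪ S) ≈ lam w * Ξ lam (contrEdges E ⁅ w ⁆) (A ─ ⁅ w ⁆) S
    Ξ-contr E A S {w} w∈A w∉S i = begin
      Ξ lam E A (⁅ w ⁆ ∪ S) ≈⟨ W-expand lam A w (admissible? E (⁅ w ⁆ ∪ S)) w∈A ⟩
      lam w * W lam (A ─ ⁅ w ⁆) (λ U → admissible? E (⁅ w ⁆ ∪ S) (U ∪ ⁅ w ⁆)) +ᴿ Ξ lam E (A ─ ⁅ w ⁆) (⁅ w ⁆ ∪ S)
        ≈⟨ +-cong (*-congˡ (W-cong lam (A ─ ⁅ w ⁆) _ (admissible? (contrEdges E ⁅ w ⁆) S)
             (λ U s → mk⇔ (λ (j , t) → indep-contr⁺ j , λ x x∈ → out U (x∈p∪q⁻ U ⁅ w ⁆ (t x (∈∪⁺ʳ x∈))) x∈)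
                          (λ (j , t) → indep-contr⁻ i j , λ x x∈ → into U t (x∈p∪q⁻ ⁅ w ⁆ S x∈)))))
             (W-none lam (A ─ ⁅ w ⁆) (admissible? E (⁅ w ⁆ ∪ S))
               (λ U s (_ , t) → ∈─⁻ʳ A ⁅ w ⁆ (s (t w (∈∪⁺ˡ (x∈⁅x⁆ w)))) (x∈⁅x⁆ w))) ⟩
      lam w * Ξ lam (contrEdges E ⁅ w ⁆) (A ─ ⁅ w ⁆) S +ᴿ 0# ≈⟨ +-identityʳ _ ⟩
      lam w * Ξ lam (contrEdges E ⁅ w ⁆) (A ─ ⁅ w ⁆) S ∎
      where
      out : ∀ U {x} → x ∈ U ⊎ x ∈ ⁅ w ⁆ → x ∈ S → x ∈ U
      out U (inj₁ a) _ = a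
      out U (inj₂ b) x∈S = ⊥-elim (w∉S (subst (_∈ S) (x∈⁅y⁆⇒x≡y w b) x∈S))
      into : ∀ U {x} → S ≼ U → x ∈ ⁅ w ⁆ ⊎ x ∈ S → x ∈ U ∪ ⁅ w ⁆
      into U t (inj₁ a) = ∈∪⁺ʳ a
      into U t (inj₂ b) = ∈∪⁺ˡ (t _ b)

    -- With `T = ⁅ w ⁆` this supplies the case that `Ξ-contr` leaves out.
    Ξ-loop : ∀ E A S {T} → ¬ Indep E T → T ≼ S → Ξ lam E A S ≈ 0#
    Ξ-loop E A S ¬i s = W-none lam A (admissible? E S) (λ U _ (i , t) → ¬i (indep-⊆ (λ x x∈ → t x (s x x∈)) i))

    -- The hyperedges that `induced` drops leave `K`, and no set inside `K` can contain them.
    Ξ-induced : ∀ G {K} S → K ≼ verts G → Ξ lam (edges (induced G K)) (verts (induced G K)) S ≈ Ξ lam (edges G) K S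
    Ξ-induced G {K} S K≼V = ≈-trans
      (reflexive (cong (λ A → Ξ lam (edges (induced G K)) A S) (verts-induced G K≼V)))
      (Ξ-edges (edges (induced G K)) (edges G) K S
        (λ U s i e e∈ e⊆ → i e (∈-induced⁺ G K≼V e∈ (λ x x∈ → s x (e⊆ x∈))) e⊆)
        (λ U s i e e∈ → i e (proj₁ (∈-induced⁻ G K≼V e∈))))

    Z-induced : ∀ G {K} → K ≼ verts G → Z R (induced G K) lam ≈ Ξ lam (edges G) K ∅
    Z-induced G K≼V = ≈-trans (Z≈Ξ (induced G _) lam) (Ξ-induced G ∅ K≼V)

  module _ {n} (lam : Fin n → Carrier) where

    prodZ-++ : ∀ Hs Hs′ → prodZ R (Hs ++ Hs′) lam ≈ prodZ R Hs lam * prodZ R Hs′ lam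
    prodZ-++ [] Hs′ = ≈-sym (*-identityˡ _)
    prodZ-++ (p ∷ Hs) Hs′ = ≈-trans (*-congˡ (prodZ-++ Hs Hs′)) (≈-sym (*-assoc _ _ _))

    prodZ-induced : ∀ G {K} Hs Hs′ → K ≼ verts G →
      prodZ R ((induced G K , 1) ∷ Hs ++ Hs′) lam ≈ Ξ lam (edges G) K ∅ * (prodZ R Hs lam * prodZ R Hs′ lam)
    prodZ-induced G Hs Hs′ K≼V = *-cong (≈-trans (*-identityʳ _) (Z-induced lam G K≼V)) (prodZ-++ Hs Hs′)

  ∏ : ∀ {A : Set} → (A → Carrier) → List A → Carrier
  ∏ f = foldr (λ x acc → f x * acc) 1#

  ∏-map : ∀ {A B : Set} (f : B → Carrier) (g : A → B) xs → ∏ f (map g xs) ≈ ∏ (f ∘ g) xs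
  ∏-map f g [] = ≈-refl
  ∏-map f g (x ∷ xs) = *-congˡ (∏-map f g xs)

  -- Partition functions of the assembled tree

  module _ {n} (lam : Fin n → Carrier) where

    -- The mark of a tree is its root, so `full` is its occupied part. The mark of a group is a
    -- hyperedge of the assembled tree without the new root, so `avoid` is what an occupied new root
    -- permits. All three are multiplicative under `⊕`.
    all full avoid : Piece n → Carrier
    all p = W (lam ∘ plab p) (verts (phg p)) (indep? (edges (phg p)))
    full p = W (lam ∘ plab p) (verts (phg p)) (λ U → indep? (edges (phg p)) U ×-dec covers? (marks p) U)
    avoid p = W (lam ∘ plab p) (verts (phg p)) (λ U → indep? (edges (phg p)) U ×-dec indep? (marks p) U)

    ⊕-W : ∀ p q {P : Subset (psize p + psize q) → Set} {P₁ P₂} (P? : Decidable P) (P₁? : Decidable P₁) (P₂? : Decidable P₂) →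
      (∀ U V → P (U Vec.++ V) ⇔ (P₁ U × P₂ V)) →
      W (lam ∘ plab (p ⊕ q)) (verts (phg p) Vec.++ verts (phg q)) P? ≈
      W (lam ∘ plab p) (verts (phg p)) P₁? * W (lam ∘ plab q) (verts (phg q)) P₂?
    ⊕-W p q P? P₁? P₂? eq = ≈-trans
      (W-++ (lam ∘ plab (p ⊕ q)) (verts (phg p)) (verts (phg q)) P? P₁? P₂? eq)
      (*-cong
        (W-cong-weights (verts (phg p)) P₁? (λ i → reflexive (cong (lam ∘ Sum.[ plab p , plab q ]) (splitAt-↑ˡ (psize p) i (psize q)))))
        (W-cong-weights (verts (phg q)) P₂? (λ i → reflexive (cong (lam ∘ Sum.[ plab p , plab q ]) (splitAt-↑ʳ (psize p) (psize q) i)))))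

    ∏-all : ∀ ps → all (foldr _⊕_ emptyPiece ps) ≈ ∏ all ps
    ∏-all [] = ≈-refl
    ∏-all (p ∷ ps) = ≈-trans
      (⊕-W p q _ _ _ (indep-lifted (edges (phg p)) (edges (phg q))))
      (*-congˡ (∏-all ps))
      where q = foldr _⊕_ emptyPiece ps

    ∏-full : ∀ ps → full (foldr _⊕_ emptyPiece ps) ≈ ∏ full ps
    ∏-full [] = ≈-refl
    ∏-full (p ∷ ps) = ≈-trans
      (⊕-W p q _ _ _ (λ U V → ×-⇔ (indep-lifted (edges (phg p)) (edges (phg q)) U V) (covers-lifted (marks p) (marks q) U V)))
      (*-congˡ (∏-full ps))
      where q = foldr _⊕_ emptyPiece ps

    ∏-avoid : ∀ ps → avoid (foldr _⊕_ emptyPiece ps) ≈ ∏ avoid ps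
    ∏-avoid [] = ≈-refl
    ∏-avoid (p ∷ ps) = ≈-trans
      (⊕-W p q _ _ _ (λ U V → ×-⇔ (indep-lifted (edges (phg p)) (edges (phg q)) U V) (indep-lifted (marks p) (marks q) U V)))
      (*-congˡ (∏-avoid ps))
      where q = foldr _⊕_ emptyPiece ps

    total rooted : RTree n → Carrier
    total = all ∘ treePiece
    rooted = full ∘ treePiece

    all-group : ∀ ts → all (groupPiece ts) ≈ ∏ total ts
    all-group ts = ≈-trans (∏-all (map treePiece ts)) (∏-map all treePiece ts)

    -- The mark of a group is filled exactly when all its roots are occupied. This is the tree's
    -- counterpart of splitting Z(H_i) according to whether the rest of `e_i` is occupied.
    avoid-group : ∀ ts → ∏ total ts ≈ avoid (groupPiece ts) +ᴿ ∏ rooted ts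
    avoid-group ts = begin
      ∏ total ts ≈⟨ all-group ts ⟨
      all p ≈⟨ W-partition (lam ∘ plab p) (verts (phg p)) (indep? (edges (phg p)))
                 (λ U → indep? (edges (phg p)) U ×-dec covers? (marks p) U)
                 (λ U → indep? (edges (phg p)) U ×-dec indep? (⋃ (marks p) ∷ []) U)
                 (λ U (i , j) → i , λ (_ , c) → j _ (here refl) (from (⋃-covers (marks p)) c _))
                 (λ U i ¬c → i , λ { e (here refl) e⊆ → ¬c (i , to (⋃-covers (marks p)) (λ _ → e⊆)) })
                 (λ U → proj₁) ⟩
      avoid (groupPiece ts) +ᴿ full p ≈⟨ +-congˡ (≈-trans (∏-full (map treePiece ts)) (∏-map full treePiece ts)) ⟩
      avoid (groupPiece ts) +ᴿ ∏ rooted ts ∎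
      where p = foldr _⊕_ emptyPiece (map treePiece ts)

    module _ (v : Fin n) (gs : List (List (RTree n))) where

      private
        p = foldr _⊕_ emptyPiece (map groupPiece gs)
        E = edges (phg p)
        E⁺ = map (false ∷_) E ++ map (true ∷_) (marks p)

        ∈-E⁺ˡ : ∀ {e} → e ∈ₗ E → (false ∷ e) ∈ₗ E⁺
        ∈-E⁺ˡ e∈ = ∈-++⁺ˡ (∈-map⁺ (false ∷_) e∈)

        ∈-E⁺ʳ : ∀ {e} → e ∈ₗ marks p → (true ∷ e) ∈ₗ E⁺
        ∈-E⁺ʳ e∈ = ∈-++⁺ʳ (map (false ∷_) E) (∈-map⁺ (true ∷_) e∈)

        indep-in : ∀ U → Indep E⁺ (true ∷ U) ⇔ (Indep E U × Indep (marks p) U)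
        indep-in U = mk⇔
          (λ i → (λ e e∈ e⊆ → i _ (∈-E⁺ˡ e∈) (out⊆ e⊆)) , (λ e e∈ e⊆ → i _ (∈-E⁺ʳ e∈) (s⊆s e⊆)))
          (λ (i , j) e e∈ → go i j (∈-++⁻ (map (false ∷_) E) e∈))
          where
          go : Indep E U → Indep (marks p) U → ∀ {e} → e ∈ₗ map (false ∷_) E ⊎ e ∈ₗ map (true ∷_) (marks p) → ¬ (e ⊆ (true ∷ U))
          go i j (inj₁ a) e⊆ with ∈-map⁻ (false ∷_) a
          ... | f , f∈ , refl = i f f∈ (drop-∷-⊆ e⊆)
          go i j (inj₂ b) e⊆ with ∈-map⁻ (true ∷_) b
          ... | f , f∈ , refl = j f f∈ (drop-∷-⊆ e⊆)

        indep-out : ∀ U → Indep E⁺ (false ∷ U) ⇔ Indep E U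
        indep-out U = mk⇔
          (λ i e e∈ e⊆ → i _ (∈-E⁺ˡ e∈) (out⊆ e⊆))
          (λ i e e∈ → go i (∈-++⁻ (map (false ∷_) E) e∈))
          where
          go : Indep E U → ∀ {e} → e ∈ₗ map (false ∷_) E ⊎ e ∈ₗ map (true ∷_) (marks p) → ¬ (e ⊆ (false ∷ U))
          go i (inj₁ a) e⊆ with ∈-map⁻ (false ∷_) a
          ... | f , f∈ , refl = i f f∈ (drop-∷-⊆ e⊆)
          go i (inj₂ b) e⊆ with ∈-map⁻ (true ∷_) b
          ... | f , f∈ , refl with e⊆ here
          ... | ()

        avoids : W (lam ∘ plab p) (verts (phg p)) (λ U → indep? E U ×-dec indep? (marks p) U) ≈ ∏ (avoid ∘ groupPiece) gs
        avoids = ≈-trans (∏-avoid (map groupPiece gs)) (∏-map avoid groupPiece gs)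

      -- If the new root is occupied, each hyperedge through it shrinks to the mark of a group,
      -- which must not be filled. If it is vacant, these hyperedges forbid nothing and the groups
      -- fall apart into their trees.
      total-assemble : total (assemble v gs) ≈ lam v * ∏ (avoid ∘ groupPiece) gs +ᴿ ∏ (∏ total) gs
      total-assemble = +-cong
        (*-congˡ (≈-trans (W-cong (lam ∘ plab p) (verts (phg p)) _ _ (λ U _ → indep-in U)) avoids))
        (≈-trans (W-cong (lam ∘ plab p) (verts (phg p)) _ _ (λ U _ → indep-out U))
          (≈-trans (∏-all (map groupPiece gs)) (≈-trans (∏-map all groupPiece gs) (groups gs))))
        where
        groups : ∀ hs → ∏ (all ∘ groupPiece) hs ≈ ∏ (∏ total) hs
        groups [] = ≈-refl
        groups (h ∷ hs) = *-cong (all-group h) (groups hs)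

      rooted-assemble : rooted (assemble v gs) ≈ lam v * ∏ (avoid ∘ groupPiece) gs
      rooted-assemble = ≈-trans
        (+-cong
          (*-congˡ (≈-trans (W-cong (lam ∘ plab p) (verts (phg p)) _ _
            (λ U _ → mk⇔ (λ (i , _) → to (indep-in U) i)
              (λ z → from (indep-in U) z , λ { e (here refl) zero here → here ; e (here refl) (suc x) (there x∈) → ⊥-elim (∉⊥ x∈) })))
            avoids))
          (W-none (lam ∘ plab p) (verts (phg p)) _ (λ { U _ (_ , c) → outside (c _ (here refl) zero here) })))
        (+-identityʳ _)
        where
        outside : ∀ {k} {U : Subset k} → ¬ (zero ∈ (false ∷ U))
        outside ()

-- The vertices of one hyperedge

IsSub-trans : ∀ {n} {H G K : Hypergraph n} → IsSub H G → IsSub G K → IsSub H K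
IsSub-trans s sub-refl = s
IsSub-trans s (sub-delV t S) = sub-delV (IsSub-trans s t) S
IsSub-trans s (sub-contr t S) = sub-contr (IsSub-trans s t) S
IsSub-trans s (sub-delE t F) = sub-delE (IsSub-trans s t) F

IsSub-verts : ∀ {n} {H G : Hypergraph n} → IsSub H G → verts G ≼ verts H
IsSub-verts sub-refl x x∈ = x∈
IsSub-verts (sub-delV s S) x x∈ = IsSub-verts s x (∈─⁻ˡ _ S x∈)
IsSub-verts (sub-contr s S) x x∈ = IsSub-verts s x (∈─⁻ˡ _ S x∈)
IsSub-verts (sub-delE s F) x x∈ = IsSub-verts s x x∈

Subs : ∀ {n} → Hypergraph n → List (Hypergraph n × ℕ) → Set
Subs H = All (λ p → IsSub H (proj₁ p) × 1 ≤ proj₂ p)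

Subs-trans : ∀ {n} {H G : Hypergraph n} {Hs} → IsSub H G → Subs G Hs → Subs H Hs
Subs-trans s = All.map (map₁ (IsSub-trans s))

EdgesNonempty : ∀ {n} → List (Subset n) → Set
EdgesNonempty E = ∀ e → e ∈ₗ E → Nonempty e

⊈⇒─-nonempty : ∀ {n} {e S : Subset n} → ¬ (e ⊆ S) → Nonempty (e ─ S)
⊈⇒─-nonempty {e = e} {S} e⊈ with nonempty? (e ─ S)
... | yes ne = ne
... | no ¬ne = ⊥-elim (e⊈ sub)
  where
  sub : e ⊆ S
  sub {x} x∈ with x ∈? S
  ... | yes a = a
  ... | no a = ⊥-elim (¬ne (x , ∈─⁺ x∈ a))

contr-nonempty : ∀ {n} (E : List (Subset n)) S → EdgesNonempty (contrEdges E S)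
contr-nonempty E S e e∈ with ∈-contr⁻ E S e∈
... | f , _ , f⊈ , refl = ⊈⇒─-nonempty f⊈

module _ {n} {E : List (Subset n)} {w : Fin n} {X U : Subset n} (w∉X : w ∉ X)
  (away : ∀ f → f ∈ₗ E → w ∈ f → ∀ x → x ∈ f → x ∉ X) (U≼X : U ≼ X) where

  -- A hyperedge through `w` misses `X`, hence so does what contraction leaves of it; being
  -- nonempty, that remainder lies in no `U`. All other hyperedges are unchanged.
  indep-avoid⁺ : Indep E U → Indep (contrEdges E ⁅ w ⁆) U
  indep-avoid⁺ i e e∈ e⊆ with ∈-contr⁻ E ⁅ w ⁆ e∈
  ... | f , f∈ , f⊈ , refl with w ∈? f | ⊈⇒─-nonempty f⊈
  ... | yes w∈f | y , y∈ = away f f∈ w∈f y (∈─⁻ˡ f ⁅ w ⁆ y∈) (U≼X y (e⊆ y∈))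
  ... | no w∉f | _ = i f f∈ (λ y∈ → e⊆ (∈─⁺ y∈ (λ y∈w → w∉f (subst (_∈ f) (x∈⁅y⁆⇒x≡y w y∈w) y∈))))

  indep-avoid⁻ : EdgesNonempty E → Indep (contrEdges E ⁅ w ⁆) U → Indep E U
  indep-avoid⁻ ne i f f∈ f⊆ = i (f ─ ⁅ w ⁆) (∈-contr⁺ E ⁅ w ⁆ f∈ f⊈) (λ y∈ → f⊆ (∈─⁻ˡ f ⁅ w ⁆ y∈))
    where
    f⊈ : ¬ (f ⊆ ⁅ w ⁆)
    f⊈ s with ne f f∈
    ... | y , y∈ = w∉X (U≼X w (subst (_∈ U) (x∈⁅y⁆⇒x≡y w (s y∈)) (f⊆ y∈)))

EqualsProduct : (R : CommutativeRing 0ℓ 0ℓ) (x y q : CommutativeRing.Carrier R) → Set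
EqualsProduct R x y q = CommutativeRing._≈_ R x (CommutativeRing._*_ R y q)

empty-product : ∀ {n} {E : List (Subset n)} → EdgesNonempty E → ∀ R lam →
  EqualsProduct R (CommutativeRing.1# R) (Sums.Ξ R lam E ∅ ∅) (CommutativeRing.1# R)
empty-product {E = E} ne R lam = sym (trans (*-identityʳ _) (Ξ-∅∅ lam E ne))
  where
  open CommutativeRing R
  open Sums R

record Factorisation {n} (H : Hypergraph n) (v : Fin n) (t : RTree n) : Set₁ where
  field
    cofactors : List (Hypergraph n × ℕ)
    cofactors-sub : Subs H cofactors
    cofactors-avoid : All (λ p → v ∉ verts (proj₁ p)) cofactors
    total-eq : ∀ R lam →
      EqualsProduct R (Sums.total R lam t) (Sums.Ξ R lam (edges H) (verts H) ∅) (prodZ R cofactors lam)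
    rooted-eq : ∀ R lam →
      EqualsProduct R (Sums.rooted R lam t) (Sums.Ξ R lam (edges H) (verts H) ⁅ v ⁆) (prodZ R cofactors lam)

-- The loop over j in the definition of the Weitz-hypertree: w is contracted before the next vertex.
data Chain {n} : Hypergraph n → List (Fin n) → List (RTree n) → Set₁ where
  [] : ∀ {G} → Chain G [] []
  chain : ∀ {G w t ws ts} (K : Subset n) → w ∈ K → K ≼ verts G → Closed (edges G) K →
    Factorisation (induced G K) w t → Chain (contr G ⁅ w ⁆) ws ts → Chain G (w ∷ ws) (t ∷ ts)

-- `hull` is the union of the components met along the chain. It contains all of `ws`, and being
-- closed in `G` it can in turn be merged with the hulls of the other hyperedges.
record ChainFactorisation {n} (G : Hypergraph n) (ws : List (Fin n)) (ts : List (RTree n)) : Set₁ where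
  field
    hull : Subset n
    hull-verts : hull ≼ verts G
    hull-closed : Closed (edges G) hull
    hull-covers : setOf ws ≼ hull
    cofactors : List (Hypergraph n × ℕ)
    cofactors-sub : Subs G cofactors
    total-eq : ∀ R lam →
      EqualsProduct R (Sums.∏ R (Sums.total R lam) ts) (Sums.Ξ R lam (edges G) hull ∅) (prodZ R cofactors lam)
    rooted-eq : ∀ R lam →
      EqualsProduct R (Sums.∏ R (Sums.rooted R lam) ts) (Sums.Ξ R lam (edges G) hull (setOf ws)) (prodZ R cofactors lam)

chain-factorisation : ∀ {n} {G : Hypergraph n} {ws ts} → EdgesNonempty (edges G) → Chain G ws ts → ChainFactorisation G ws ts
chain-factorisation {G = G} ne [] = record
  { hull = ∅
  ; hull-verts = λ _ x∈ → ⊥-elim (∉⊥ x∈)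
  ; hull-closed = λ _ _ _ _ x∈ → ⊥-elim (∉⊥ x∈)
  ; hull-covers = λ _ x∈ → x∈
  ; cofactors = []
  ; cofactors-sub = []
  ; total-eq = empty-product ne
  ; rooted-eq = empty-product ne
  }
chain-factorisation {n} {G = G} {w ∷ ws} {t ∷ ts} ne (chain K w∈K K≼V closed fac rest) = record
  { hull = K ∪ L
  ; hull-verts = λ x x∈ → [ K≼V x , (λ x∈L → ∈─⁻ˡ (verts G) ⁅ w ⁆ (Rest.hull-verts x x∈L)) ]′ (x∈p∪q⁻ K L x∈)
  ; hull-closed = closed∪
  ; hull-covers = λ x x∈ → [ (λ x∈w → ∈∪⁺ˡ (subst (_∈ K) (≡.sym (x∈⁅y⁆⇒x≡y w x∈w)) w∈K)) ,
                             (λ x∈S → ∈∪⁺ʳ (Rest.hull-covers x x∈S)) ]′ (x∈p∪q⁻ ⁅ w ⁆ S x∈)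
  -- The overlap is taken in `G′` because `K` is kept whole in `G`, and it is `L`, living in `G′`,
  -- that is cut along `K`.
  ; cofactors = (induced G′ (L ∩ K) , 1) ∷ First.cofactors ++ Rest.cofactors
  ; cofactors-sub = (sub-delV (sub-contr sub-refl ⁅ w ⁆) _ , ≤-refl) ∷
      AllP.++⁺ (Subs-trans (sub-delV sub-refl _) First.cofactors-sub) (Subs-trans (sub-contr sub-refl ⁅ w ⁆) Rest.cofactors-sub)
  ; total-eq = total-eq
  ; rooted-eq = rooted-eq
  }
  where
  G′ = contr G ⁅ w ⁆
  E = edges G
  E′ = edges G′
  module First = Factorisation fac
  module Rest = ChainFactorisation (chain-factorisation (contr-nonempty E ⁅ w ⁆) rest)
  L = Rest.hull
  S = setOf ws

  w∉L : w ∉ L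
  w∉L w∈L = ∈─⁻ʳ (verts G) ⁅ w ⁆ (Rest.hull-verts w w∈L) (x∈⁅x⁆ w)

  -- A hyperedge meeting `L` either contains `w`, and then lies in `K`, or is untouched by the
  -- contraction, and then lies in `L`.
  closed∪ : Closed E (K ∪ L)
  closed∪ e e∈ x x∈e x∈ y y∈e with w ∈? e | x∈p∪q⁻ K L x∈
  ... | _ | inj₁ x∈K = ∈∪⁺ˡ (closed e e∈ x x∈e x∈K y y∈e)
  ... | yes w∈e | inj₂ _ = ∈∪⁺ˡ (closed e e∈ w w∈e w∈K y y∈e)
  ... | no w∉e | inj₂ x∈L = ∈∪⁺ʳ (Rest.hull-closed (e ─ ⁅ w ⁆) (∈-contr⁺ E ⁅ w ⁆ e∈ e⊈) x (keep x∈e) x∈L y (keep y∈e))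
    where
    keep : ∀ {z} → z ∈ e → z ∈ e ─ ⁅ w ⁆
    keep z∈ = ∈─⁺ z∈ (λ z∈w → w∉e (subst (_∈ e) (x∈⁅y⁆⇒x≡y w z∈w) z∈))
    e⊈ : ¬ (e ⊆ ⁅ w ⁆)
    e⊈ s = ∈─⁻ʳ e ⁅ w ⁆ (keep x∈e) (s x∈e)

  module _ (R : CommutativeRing 0ℓ 0ℓ) (lam : Fin n → CommutativeRing.Carrier R) where
    open CommutativeRing R renaming (_+_ to _+ᴿ_; refl to ≈-refl; sym to ≈-sym; trans to ≈-trans) hiding (zero)
    open import Relation.Binary.Reasoning.Setoid setoid
    open import Algebra.Solver.Ring.NaturalCoefficients.Default commutativeSemiring using (solve; _:=_; _:+_; _:*_)
    open Sums R

    q₁ = prodZ R First.cofactors lam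
    q₂ = prodZ R Rest.cofactors lam

    -- All hyperedges through `w` stay in the closed set `K`, so contracting `w` is invisible
    -- outside `K`.
    outside : ∀ T → Ξ lam E (L ─ K) T ≈ Ξ lam E′ (L ─ K) T
    outside T = Ξ-edges lam E E′ (L ─ K) T (λ U s → indep-avoid⁺ w∉ away s) (λ U s → indep-avoid⁻ w∉ away s ne)
      where
      w∉ : w ∉ L ─ K
      w∉ w∈ = ∈─⁻ʳ L K w∈ w∈K
      away : ∀ f → f ∈ₗ E → w ∈ f → ∀ x → x ∈ f → x ∉ L ─ K
      away f f∈ w∈f x x∈f x∈ = ∈─⁻ʳ L K x∈ (closed f f∈ w w∈f w∈K x x∈f)

    split-hull : ∀ T → Ξ lam E (K ∪ L) T ≈ Ξ lam E K (T ∩ K) * Ξ lam E′ (L ─ K) (T ─ K)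
    split-hull T = ≈-trans (Ξ-split lam E (K ∪ L) T closed) (*-cong
      (Ξ-domain lam E (T ∩ K) (λ x → ∈∩⁻ʳ (K ∪ L) K) (λ x x∈ → ∈∩⁺ (∈∪⁺ˡ x∈) x∈))
      (≈-trans
        (Ξ-domain lam E (T ─ K) (λ x x∈ → ∈─⁺ ([ (λ a → ⊥-elim (∈─⁻ʳ (K ∪ L) K x∈ a)) , id ]′ (x∈p∪q⁻ K L (∈─⁻ˡ (K ∪ L) K x∈))) (∈─⁻ʳ (K ∪ L) K x∈))
                     (λ x x∈ → ∈─⁺ (∈∪⁺ʳ (∈─⁻ˡ L K x∈)) (∈─⁻ʳ L K x∈)))
        (outside (T ─ K))))

    split-L : ∀ T → Ξ lam E′ L T ≈ Ξ lam E′ (L ∩ K) (T ∩ K) * Ξ lam E′ (L ─ K) (T ─ K)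
    split-L T = Ξ-split lam E′ L T (Closed-contr closed)

    first : ∀ T → Ξ lam (edges (induced G K)) (verts (induced G K)) T ≈ Ξ lam E K T
    first T = Ξ-induced lam G T K≼V

    ∅∩ : ∀ A → ∅ ∩ A ≡ ∅
    ∅∩ A = ∩-zeroˡ A

    ∅─ : ∀ A → ∅ ─ A ≡ ∅
    ∅─ A = ≼-antisym (λ x → ∈─⁻ˡ ∅ A) (λ x x∈ → ⊥-elim (∉⊥ x∈))

    factors = prodZ-induced lam G′ First.cofactors Rest.cofactors (λ x x∈ → Rest.hull-verts x (∈∩⁻ˡ L K x∈))

    total-eq : ∏ (total lam) (t ∷ ts) ≈ Ξ lam E (K ∪ L) ∅ * prodZ R ((induced G′ (L ∩ K) , 1) ∷ First.cofactors ++ Rest.cofactors) lam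
    total-eq = begin
      total lam t * ∏ (total lam) ts ≈⟨ *-cong (≈-trans (First.total-eq R lam) (*-congʳ (first ∅))) (Rest.total-eq R lam) ⟩
      (Ξ lam E K ∅ * q₁) * (Ξ lam E′ L ∅ * q₂)
        ≈⟨ *-congˡ (*-congʳ (≈-trans (split-L ∅) (reflexive (≡.cong₂ (λ A B → Ξ lam E′ (L ∩ K) A * Ξ lam E′ (L ─ K) B) (∅∩ K) (∅─ K))))) ⟩
      (Ξ lam E K ∅ * q₁) * ((Ξ lam E′ (L ∩ K) ∅ * Ξ lam E′ (L ─ K) ∅) * q₂)
        ≈⟨ solve 5 (λ a q m r p → ((a :* q) :* ((m :* r) :* p)) := ((a :* r) :* (m :* (q :* p)))) ≈-refl _ q₁ _ _ q₂ ⟩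
      (Ξ lam E K ∅ * Ξ lam E′ (L ─ K) ∅) * (Ξ lam E′ (L ∩ K) ∅ * (q₁ * q₂))
        ≈⟨ *-cong (≈-trans (split-hull ∅) (reflexive (≡.cong₂ (λ A B → Ξ lam E K A * Ξ lam E′ (L ─ K) B) (∅∩ K) (∅─ K)))) factors ⟨
      Ξ lam E (K ∪ L) ∅ * prodZ R ((induced G′ (L ∩ K) , 1) ∷ First.cofactors ++ Rest.cofactors) lam ∎

    -- If w is occupied, L ∩ K splits off from K, so requiring S ∩ K in addition affects only the
    -- factor of L ∩ K.
    exchange : Ξ lam E K ⁅ w ⁆ * Ξ lam E′ (L ∩ K) (S ∩ K) ≈ Ξ lam E K (⁅ w ⁆ ∪ (S ∩ K)) * Ξ lam E′ (L ∩ K) ∅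
    exchange with indep? E ⁅ w ⁆
    ... | no loop = ≈-trans (*-congʳ (Ξ-loop lam E K ⁅ w ⁆ loop (λ _ a → a)))
      (≈-trans (≈-trans (zeroˡ _) (≈-sym (zeroˡ _)))
        (*-congʳ (≈-sym (Ξ-loop lam E K (⁅ w ⁆ ∪ (S ∩ K)) loop (λ _ → ∈∪⁺ˡ)))))
    ... | yes i = begin
      Ξ lam E K ⁅ w ⁆ * m₁ ≈⟨ *-congʳ (≈-trans (reflexive (cong (Ξ lam E K) (≡.sym (∪-identityʳ ⁅ w ⁆)))) (expand ∅ (λ _ x∈ → ⊥-elim (∉⊥ x∈)))) ⟩
      (lam w * (Ξ lam E′ (L ∩ K) (∅ ∩ L) * s)) * m₁ ≈⟨ *-congʳ (*-congˡ (*-congʳ (reflexive (cong (Ξ lam E′ (L ∩ K)) (∅∩ L))))) ⟩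
      (lam w * (m₀ * s)) * m₁ ≈⟨ solve 4 (λ l a b c → ((l :* (a :* b)) :* c) := ((l :* (c :* b)) :* a)) ≈-refl (lam w) m₀ s m₁ ⟩
      (lam w * (m₁ * s)) * m₀
        ≈⟨ *-congʳ (≈-trans (expand (S ∩ K) S∩K≼L)
             (*-congˡ (*-congʳ (Ξ-required lam E′ (L ∩ K) (λ _ → ∈∩⁻ˡ (S ∩ K) L) (λ x x∈ → ∈∩⁺ x∈ (S∩K≼L x x∈)))))) ⟨
      Ξ lam E K (⁅ w ⁆ ∪ (S ∩ K)) * m₀ ∎
      where
      m₀ = Ξ lam E′ (L ∩ K) ∅
      m₁ = Ξ lam E′ (L ∩ K) (S ∩ K)
      s = Ξ lam E′ (K ─ ⁅ w ⁆ ─ L) ∅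
      S∩K≼L : S ∩ K ≼ L
      S∩K≼L x x∈ = Rest.hull-covers x (∈∩⁻ˡ S K x∈)
      -- Contracting `w` moves the sum into `G′`, where `L` is closed. Cutting along `L` leaves a
      -- remainder `s` that does not depend on `T`, since `T` lies in `L`.
      expand : ∀ T → T ≼ L → Ξ lam E K (⁅ w ⁆ ∪ T) ≈ lam w * (Ξ lam E′ (L ∩ K) (T ∩ L) * s)
      expand T T≼L = ≈-trans (Ξ-contr lam E K T w∈K (λ w∈T → w∉L (T≼L w w∈T)) i)
        (*-congˡ (≈-trans (Ξ-split lam E′ (K ─ ⁅ w ⁆) T Rest.hull-closed) (*-cong
          (Ξ-domain lam E′ (T ∩ L)
            (λ x x∈ → ∈∩⁺ (∈∩⁻ʳ (K ─ ⁅ w ⁆) L x∈) (∈─⁻ˡ K ⁅ w ⁆ (∈∩⁻ˡ (K ─ ⁅ w ⁆) L x∈)))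
            (λ x x∈ → ∈∩⁺ (∈─⁺ (∈∩⁻ʳ L K x∈) (λ x∈w → w∉L (subst (_∈ L) (x∈⁅y⁆⇒x≡y w x∈w) (∈∩⁻ˡ L K x∈)))) (∈∩⁻ˡ L K x∈)))
          (Ξ-required lam E′ (K ─ ⁅ w ⁆ ─ L) (λ x x∈ → ⊥-elim (∈─⁻ʳ T L x∈ (T≼L x (∈─⁻ˡ T L x∈)))) (λ x x∈ → ⊥-elim (∉⊥ x∈))))))

    rooted-eq : ∏ (rooted lam) (t ∷ ts) ≈
      Ξ lam E (K ∪ L) (⁅ w ⁆ ∪ S) * prodZ R ((induced G′ (L ∩ K) , 1) ∷ First.cofactors ++ Rest.cofactors) lam
    rooted-eq = begin
      rooted lam t * ∏ (rooted lam) ts ≈⟨ *-cong (≈-trans (First.rooted-eq R lam) (*-congʳ (first ⁅ w ⁆))) (≈-trans (Rest.rooted-eq R lam) (*-congʳ (split-L S))) ⟩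
      (Ξ lam E K ⁅ w ⁆ * q₁) * ((Ξ lam E′ (L ∩ K) (S ∩ K) * Ξ lam E′ (L ─ K) (S ─ K)) * q₂)
        ≈⟨ solve 5 (λ a q m r p → ((a :* q) :* ((m :* r) :* p)) := ((a :* m) :* (r :* (q :* p)))) ≈-refl _ q₁ _ _ q₂ ⟩
      (Ξ lam E K ⁅ w ⁆ * Ξ lam E′ (L ∩ K) (S ∩ K)) * (Ξ lam E′ (L ─ K) (S ─ K) * (q₁ * q₂)) ≈⟨ *-congʳ exchange ⟩
      (Ξ lam E K (⁅ w ⁆ ∪ (S ∩ K)) * Ξ lam E′ (L ∩ K) ∅) * (Ξ lam E′ (L ─ K) (S ─ K) * (q₁ * q₂))
        ≈⟨ solve 4 (λ a m r q → ((a :* m) :* (r :* q)) := ((a :* r) :* (m :* q))) ≈-refl _ _ _ _ ⟩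
      (Ξ lam E K (⁅ w ⁆ ∪ (S ∩ K)) * Ξ lam E′ (L ─ K) (S ─ K)) * (Ξ lam E′ (L ∩ K) ∅ * (q₁ * q₂))
        ≈⟨ *-cong (≈-trans (split-hull (⁅ w ⁆ ∪ S)) (*-cong
             (Ξ-required lam E K in⁺ in⁻) (Ξ-required lam E′ (L ─ K) out⁺ out⁻))) factors ⟨
      Ξ lam E (K ∪ L) (⁅ w ⁆ ∪ S) * prodZ R ((induced G′ (L ∩ K) , 1) ∷ First.cofactors ++ Rest.cofactors) lam ∎
      where
      in⁺ : (⁅ w ⁆ ∪ S) ∩ K ≼ ⁅ w ⁆ ∪ (S ∩ K)
      in⁺ x x∈ with x∈p∪q⁻ ⁅ w ⁆ S (∈∩⁻ˡ (⁅ w ⁆ ∪ S) K x∈)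
      ... | inj₁ a = ∈∪⁺ˡ a
      ... | inj₂ b = ∈∪⁺ʳ (∈∩⁺ b (∈∩⁻ʳ (⁅ w ⁆ ∪ S) K x∈))
      in⁻ : ⁅ w ⁆ ∪ (S ∩ K) ≼ (⁅ w ⁆ ∪ S) ∩ K
      in⁻ x x∈ with x∈p∪q⁻ ⁅ w ⁆ (S ∩ K) x∈
      ... | inj₁ a = ∈∩⁺ (∈∪⁺ˡ a) (subst (_∈ K) (≡.sym (x∈⁅y⁆⇒x≡y w a)) w∈K)
      ... | inj₂ b = ∈∩⁺ (∈∪⁺ʳ (∈∩⁻ˡ S K b)) (∈∩⁻ʳ S K b)
      out⁺ : (⁅ w ⁆ ∪ S) ─ K ≼ S ─ K
      out⁺ x x∈ with x∈p∪q⁻ ⁅ w ⁆ S (∈─⁻ˡ (⁅ w ⁆ ∪ S) K x∈)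
      ... | inj₁ a = ⊥-elim (∈─⁻ʳ (⁅ w ⁆ ∪ S) K x∈ (subst (_∈ K) (≡.sym (x∈⁅y⁆⇒x≡y w a)) w∈K))
      ... | inj₂ b = ∈─⁺ b (∈─⁻ʳ (⁅ w ⁆ ∪ S) K x∈)
      out⁻ : S ─ K ≼ (⁅ w ⁆ ∪ S) ─ K
      out⁻ x x∈ = ∈─⁺ (∈∪⁺ʳ (∈─⁻ˡ S K x∈)) (∈─⁻ʳ S K x∈)

-- The hyperedges at one vertex

module _ {n} (H : Hypergraph n) where

  ∈-delE⁺ : ∀ {F e} → e ∈ₗ edges H → e ∉ₗ F → e ∈ₗ edges (delE H F)
  ∈-delE⁺ {F} = ∈-filter⁺ (λ e → ¬? (DecMem._∈?_ _≟ₛ_ e F))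

  ∈-delE⁻ : ∀ {F e} → e ∈ₗ edges (delE H F) → e ∈ₗ edges H × e ∉ₗ F
  ∈-delE⁻ {F} = ∈-filter⁻ (λ e → ¬? (DecMem._∈?_ _≟ₛ_ e F))

  ∈-delV⁺ : ∀ {v e} → e ∈ₗ edges H → v ∉ e → e ∈ₗ edges (delV H ⁅ v ⁆)
  ∈-delV⁺ {v} {e} e∈ v∉ = ∈-filter⁺ (λ e → ¬? (nonempty? (e ∩ ⁅ v ⁆))) e∈
    (λ (x , x∈) → v∉ (subst (_∈ e) (x∈⁅y⁆⇒x≡y v (∈∩⁻ʳ e ⁅ v ⁆ x∈)) (∈∩⁻ˡ e ⁅ v ⁆ x∈)))

  ∈-delV⁻ : ∀ {v e} → e ∈ₗ edges (delV H ⁅ v ⁆) → e ∈ₗ edges H × v ∉ e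
  ∈-delV⁻ {v} {e} e∈ with ∈-filter⁻ (λ e → ¬? (nonempty? (e ∩ ⁅ v ⁆))) e∈
  ... | e∈H , empty = e∈H , λ v∈e → empty (v , ∈∩⁺ v∈e (x∈⁅x⁆ v))

─-∉ : ∀ {n} {e : Subset n} {v} → v ∉ e → e ─ ⁅ v ⁆ ≡ e
─-∉ {e = e} {v} v∉ = ≼-antisym (λ x → ∈─⁻ˡ e ⁅ v ⁆)
  (λ x x∈ → ∈─⁺ x∈ (λ x∈v → v∉ (subst (_∈ e) (x∈⁅y⁆⇒x≡y v x∈v) x∈)))

module _ {n} (H : Hypergraph n) (v : Fin n) where

  -- The telescope runs from `F = []`, which gives H ⊖ v, to `F` consisting of all hyperedges at
  -- `v`, which for nonempty hyperedges gives those of H - v.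
  linkAfter : List (Subset n) → Hypergraph n
  linkAfter F = contr (delE H F) ⁅ v ⁆

  -- The loop over i in the definition of the Weitz-hypertree; F lists the hyperedges deleted so far.
  data Groups : List (Subset n) → List (Subset n) → List (List (RTree n)) → Set₁ where
    [] : ∀ {F} → Groups F [] []
    group : ∀ {F e rest ws ts gs} → e ∈ₗ edges H → v ∈ e → e ∉ₗ F → setOf ws ≡ e ─ ⁅ v ⁆ →
      Chain (linkAfter (F ++ [ e ])) ws ts → Groups (F ++ [ e ]) rest gs → Groups F (e ∷ rest) (ts ∷ gs)

  -- With i hyperedges in `F`, the groups still to come represent Z(H_i) / Z(H - v) on `hull`. The
  -- numerator is `avoid-eq`; the denominator `total-eq` refers to the same hypergraph at every
  -- stage.
  record GroupsFactorisation (F rest : List (Subset n)) (gs : List (List (RTree n))) : Set₁ where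
    field
      hull : Subset n
      hull-verts : hull ≼ verts H ─ ⁅ v ⁆
      hull-closed : Closed (edges (linkAfter F)) hull
      hull-covers : ∀ e → e ∈ₗ rest → e ─ ⁅ v ⁆ ≼ hull
      cofactors : List (Hypergraph n × ℕ)
      cofactors-sub : Subs H cofactors
      cofactors-avoid : All (λ p → v ∉ verts (proj₁ p)) cofactors
      total-eq : ∀ R lam →
        EqualsProduct R (Sums.∏ R (Sums.∏ R (Sums.total R lam)) gs) (Sums.Ξ R lam (edges (delV H ⁅ v ⁆)) hull ∅) (prodZ R cofactors lam)
      -- Contracting v drops a hyperedge ⁅ v ⁆ instead of making v unusable; hence the hypothesis.
      avoid-eq : Indep rest ⁅ v ⁆ → ∀ R lam →
        EqualsProduct R (Sums.∏ R (Sums.avoid R lam ∘ groupPiece) gs) (Sums.Ξ R lam (edges (linkAfter F)) hull ∅) (prodZ R cofactors lam)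

  groups-factorisation : ∀ {F rest gs} → EdgesNonempty (edges H) →
    (∀ f → f ∈ₗ F → v ∈ f) → (∀ f → f ∈ₗ edges H → v ∈ f → f ∈ₗ F ⊎ f ∈ₗ rest) →
    Groups F rest gs → GroupsFactorisation F rest gs
  groups-factorisation {F} ne _ _ [] = record
    { hull = ∅
    ; hull-verts = λ _ x∈ → ⊥-elim (∉⊥ x∈)
    ; hull-closed = λ _ _ _ _ x∈ → ⊥-elim (∉⊥ x∈)
    ; hull-covers = λ _ ()
    ; cofactors = []
    ; cofactors-sub = []
    ; cofactors-avoid = []
    ; total-eq = empty-product (λ e e∈ → ne e (proj₁ (∈-delV⁻ H e∈)))
    ; avoid-eq = λ _ → empty-product (contr-nonempty (edges (delE H F)) ⁅ v ⁆)
    }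
  groups-factorisation {F} {e ∷ rest} {ts ∷ gs} ne F∋v known (group {ws = ws} e∈H v∈e e∉F ws≡ links others) = record
    { hull = K ∪ M
    ; hull-verts = λ x x∈ → [ First.hull-verts x , Rest.hull-verts x ]′ (x∈p∪q⁻ K M x∈)
    ; hull-closed = closed∪
    ; hull-covers = λ { f (here refl) x x∈ → ∈∪⁺ˡ (e≼K x x∈) ; f (there f∈) x x∈ → ∈∪⁺ʳ (Rest.hull-covers f f∈ x x∈) }
    ; cofactors = Hs
    ; cofactors-sub = (sub-delV (sub-contr (sub-delE sub-refl F′) ⁅ v ⁆) _ , ≤-refl) ∷
        AllP.++⁺ (Subs-trans G′-sub First.cofactors-sub) Rest.cofactors-sub
    ; cofactors-avoid = (λ v∈ → v∉G′ (∈─⁻ˡ (verts G′) (verts G′ ─ (K ∩ M)) v∈)) ∷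
        AllP.++⁺ (All.map (λ (s , _) v∈ → v∉G′ (IsSub-verts s v v∈)) First.cofactors-sub) Rest.cofactors-avoid
    ; total-eq = total-eq
    ; avoid-eq = avoid-eq
    }
    where
    F′ = F ++ [ e ]
    G′ = linkAfter F′
    A = edges (linkAfter F)
    A′ = edges G′
    E° = edges (delV H ⁅ v ⁆)

    F′∋v : ∀ f → f ∈ₗ F′ → v ∈ f
    F′∋v f f∈ with ∈-++⁻ F f∈
    ... | inj₁ a = F∋v f a
    ... | inj₂ (here refl) = v∈e

    known′ : ∀ f → f ∈ₗ edges H → v ∈ f → f ∈ₗ F′ ⊎ f ∈ₗ rest
    known′ f f∈ v∈ with known f f∈ v∈
    ... | inj₁ a = inj₁ (∈-++⁺ˡ a)
    ... | inj₂ (here refl) = inj₁ (∈-++⁺ʳ F (here refl))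
    ... | inj₂ (there b) = inj₂ b

    module First = ChainFactorisation (chain-factorisation (contr-nonempty (edges (delE H F′)) ⁅ v ⁆) links)
    module Rest = GroupsFactorisation (groups-factorisation ne F′∋v known′ others)
    K = First.hull
    M = Rest.hull
    -- One overlap serves both equations: `total-eq` cuts `K` along `M` and `avoid-eq` cuts `M`
    -- along `K`, both in `G′`.
    Hs = (induced G′ (K ∩ M) , 1) ∷ First.cofactors ++ Rest.cofactors

    G′-sub : IsSub H G′
    G′-sub = sub-contr (sub-delE sub-refl F′) ⁅ v ⁆

    v∉G′ : v ∉ verts G′
    v∉G′ v∈ = ∈─⁻ʳ (verts H) ⁅ v ⁆ v∈ (x∈⁅x⁆ v)

    e≼K : e ─ ⁅ v ⁆ ≼ K
    e≼K = subst (_≼ K) ws≡ First.hull-covers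

    A-cases : ∀ g → g ∈ₗ A → g ≡ e ─ ⁅ v ⁆ ⊎ g ∈ₗ A′
    A-cases g g∈ with ∈-contr⁻ (edges (delE H F)) ⁅ v ⁆ g∈
    ... | f , f∈ , f⊈ , refl with f ≟ₛ e | ∈-delE⁻ H f∈
    ... | yes refl | _ = inj₁ refl
    ... | no f≢e | f∈H , f∉F = inj₂ (∈-contr⁺ (edges (delE H F′)) ⁅ v ⁆ (∈-delE⁺ H f∈H f∉F′) f⊈)
      where
      f∉F′ : f ∉ₗ F′
      f∉F′ f∈F′ with ∈-++⁻ F f∈F′
      ... | inj₁ a = f∉F a
      ... | inj₂ (here f≡e) = f≢e f≡e

    A′⊆A : ∀ g → g ∈ₗ A′ → g ∈ₗ A
    A′⊆A g g∈ with ∈-contr⁻ (edges (delE H F′)) ⁅ v ⁆ g∈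
    ... | f , f∈ , f⊈ , refl with ∈-delE⁻ H f∈
    ... | f∈H , f∉F′ = ∈-contr⁺ (edges (delE H F)) ⁅ v ⁆ (∈-delE⁺ H f∈H (λ f∈F → f∉F′ (∈-++⁺ˡ f∈F))) f⊈

    E°⊆A′ : ∀ f → f ∈ₗ E° → f ∈ₗ A′
    E°⊆A′ f f∈ with ∈-delV⁻ H f∈
    ... | f∈H , v∉f = subst (_∈ₗ A′) (─-∉ v∉f)
      (∈-contr⁺ (edges (delE H F′)) ⁅ v ⁆ (∈-delE⁺ H f∈H (λ f∈F′ → v∉f (F′∋v f f∈F′))) f⊈)
      where
      f⊈ : ¬ (f ⊆ ⁅ v ⁆)
      f⊈ s with ne f f∈H
      ... | y , y∈ = v∉f (subst (_∈ f) (x∈⁅y⁆⇒x≡y v (s y∈)) y∈)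

    -- Restoring `e` does no harm, because what remains of `e` without `v` lies in `K`.
    K-closed : Closed A K
    K-closed g g∈ x x∈g x∈K with A-cases g g∈
    ... | inj₁ refl = e≼K
    ... | inj₂ g∈′ = First.hull-closed g g∈′ x x∈g x∈K

    closed∪ : Closed A (K ∪ M)
    closed∪ g g∈ x x∈g x∈ with A-cases g g∈ | x∈p∪q⁻ K M x∈
    ... | inj₁ refl | _ = λ y y∈ → ∈∪⁺ˡ (e≼K y y∈)
    ... | inj₂ g∈′ | inj₁ x∈K = λ y y∈ → ∈∪⁺ˡ (First.hull-closed g g∈′ x x∈g x∈K y y∈)
    ... | inj₂ g∈′ | inj₂ x∈M = λ y y∈ → ∈∪⁺ʳ (Rest.hull-closed g g∈′ x x∈g x∈M y y∈)

    M-closed° : Closed E° M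
    M-closed° g g∈ = Rest.hull-closed g (E°⊆A′ g g∈)

    K─M≼ : K ─ M ≼ verts H ─ ⁅ v ⁆
    K─M≼ x x∈ = First.hull-verts x (∈─⁻ˡ K M x∈)

    module _ (R : CommutativeRing 0ℓ 0ℓ) (lam : Fin n → CommutativeRing.Carrier R) where
      open CommutativeRing R renaming (_+_ to _+ᴿ_; refl to ≈-refl; sym to ≈-sym; trans to ≈-trans) hiding (zero)
      open import Relation.Binary.Reasoning.Setoid setoid
      open import Algebra.Solver.Ring.NaturalCoefficients.Default commutativeSemiring using (solve; _:=_; _:+_; _:*_)
      open Sums R

      q₁ = prodZ R First.cofactors lam
      q₂ = prodZ R Rest.cofactors lam

      factors : prodZ R Hs lam ≈ Ξ lam A′ (K ∩ M) ∅ * (q₁ * q₂)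
      factors = prodZ-induced lam G′ First.cofactors Rest.cofactors (λ x x∈ → First.hull-verts x (∈∩⁻ˡ K M x∈))

      split : ∀ E X {Y} → Closed E Y → Ξ lam E X ∅ ≈ Ξ lam E (X ∩ Y) ∅ * Ξ lam E (X ─ Y) ∅
      split E X {Y} closed = ≈-trans (Ξ-split lam E X ∅ closed) (*-cong
        (Ξ-required lam E (X ∩ Y) (λ x → ∈∩⁻ˡ ∅ Y) (λ x x∈ → ⊥-elim (∉⊥ x∈)))
        (Ξ-required lam E (X ─ Y) (λ x → ∈─⁻ˡ ∅ Y) (λ x x∈ → ⊥-elim (∉⊥ x∈))))

      split-∪ : ∀ E X {Y} → Closed E Y → Ξ lam E (X ∪ Y) ∅ ≈ Ξ lam E Y ∅ * Ξ lam E (X ─ Y) ∅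
      split-∪ E X {Y} closed = ≈-trans (split E (X ∪ Y) closed) (*-cong
        (Ξ-domain lam E ∅ (λ x → ∈∩⁻ʳ (X ∪ Y) Y) (λ x x∈ → ∈∩⁺ (∈∪⁺ʳ x∈) x∈))
        (Ξ-domain lam E ∅
          (λ x x∈ → ∈─⁺ ([ id , (λ b → ⊥-elim (∈─⁻ʳ (X ∪ Y) Y x∈ b)) ]′ (x∈p∪q⁻ X Y (∈─⁻ˡ (X ∪ Y) Y x∈))) (∈─⁻ʳ (X ∪ Y) Y x∈))
          (λ x x∈ → ∈─⁺ (∈∪⁺ˡ (∈─⁻ˡ X Y x∈)) (∈─⁻ʳ X Y x∈))))

      -- A hyperedge at `v` that is not yet deleted belongs to `rest`, so apart from `v` it lies in
      -- `M`. Outside `M` nothing distinguishes H_i from H - v.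
      outside-M : Ξ lam A′ (K ─ M) ∅ ≈ Ξ lam E° (K ─ M) ∅
      outside-M = Ξ-edges lam A′ E° (K ─ M) ∅
        (λ U s i f f∈ → i f (E°⊆A′ f f∈))
        (λ U s i → indep-avoid⁺ v∉ away s (λ f f∈ f⊆ → i f (∈-delV⁺ H (proj₁ (∈-delE⁻ H f∈)) (λ v∈f → v∉ (s v (f⊆ v∈f)))) f⊆))
        where
        v∉ : v ∉ K ─ M
        v∉ v∈ = ∈─⁻ʳ (verts H) ⁅ v ⁆ (K─M≼ v v∈) (x∈⁅x⁆ v)
        away : ∀ f → f ∈ₗ edges (delE H F′) → v ∈ f → ∀ x → x ∈ f → x ∉ K ─ M
        away f f∈ v∈f x x∈f x∈ with ∈-delE⁻ H f∈
        ... | f∈H , f∉F′ with known′ f f∈H v∈f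
        ... | inj₁ f∈F′ = f∉F′ f∈F′
        ... | inj₂ f∈rest = ∈─⁻ʳ K M x∈ (Rest.hull-covers f f∈rest x (∈─⁺ x∈f (∈─⁻ʳ (verts H) ⁅ v ⁆ (K─M≼ x x∈))))

      total-eq : ∏ (∏ (total lam)) (ts ∷ gs) ≈ Ξ lam E° (K ∪ M) ∅ * prodZ R Hs lam
      total-eq = begin
        ∏ (total lam) ts * ∏ (∏ (total lam)) gs ≈⟨ *-cong (First.total-eq R lam) (Rest.total-eq R lam) ⟩
        (Ξ lam A′ K ∅ * q₁) * (Ξ lam E° M ∅ * q₂) ≈⟨ *-congʳ (*-congʳ (≈-trans (split A′ K Rest.hull-closed) (*-congˡ outside-M))) ⟩
        ((Ξ lam A′ (K ∩ M) ∅ * Ξ lam E° (K ─ M) ∅) * q₁) * (Ξ lam E° M ∅ * q₂)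
          ≈⟨ solve 5 (λ m r q a p → (((m :* r) :* q) :* (a :* p)) := ((a :* r) :* (m :* (q :* p)))) ≈-refl _ _ q₁ _ q₂ ⟩
        (Ξ lam E° M ∅ * Ξ lam E° (K ─ M) ∅) * (Ξ lam A′ (K ∩ M) ∅ * (q₁ * q₂)) ≈⟨ *-cong (split-∪ E° K M-closed°) factors ⟨
        Ξ lam E° (K ∪ M) ∅ * prodZ R Hs lam ∎

      module _ (noLoop : Indep (e ∷ rest) ⁅ v ⁆) where

        e∈A : (e ─ ⁅ v ⁆) ∈ₗ A
        e∈A = ∈-contr⁺ (edges (delE H F)) ⁅ v ⁆ (∈-delE⁺ H e∈H e∉F) (noLoop e (here refl))

        inclusion-exclusion : Ξ lam A′ K ∅ ≈ Ξ lam A K ∅ +ᴿ Ξ lam A′ K (setOf ws)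
        inclusion-exclusion = W-partition lam K (admissible? A′ ∅) (admissible? A′ (setOf ws)) (admissible? A ∅)
          (λ U (i , s) → ((λ g g∈ → i g (A′⊆A g g∈)) , s) , λ (_ , t) → i _ e∈A (λ {x} x∈ → t x (subst (x ∈_) (≡.sym ws≡) x∈)))
          (λ U (i , s) ¬t → (λ g g∈ g⊆ → new i ¬t g⊆ (A-cases g g∈)) , s)
          (λ U (i , _) → i , λ x x∈ → ⊥-elim (∉⊥ x∈))
          where
          new : ∀ {U g} → Indep A′ U → ¬ Admissible A′ (setOf ws) U → g ⊆ U → g ≡ e ─ ⁅ v ⁆ ⊎ g ∈ₗ A′ → ⊥
          new i ¬t g⊆ (inj₁ refl) = ¬t (i , λ x x∈ → g⊆ (subst (x ∈_) ws≡ x∈))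
          new i ¬t g⊆ (inj₂ g∈′) = i _ g∈′ g⊆

        -- `avoid-group` and `inclusion-exclusion` are the same decomposition on the two sides. The
        -- chain matches totals and occupied parts with one cofactor `q₁`, so the remaining summands
        -- agree by cancellation.
        avoid-first : avoid lam (groupPiece ts) ≈ Ξ lam A K ∅ * q₁
        avoid-first = GroupProperties.∙-cancelʳ +-group (Ξ lam A′ K (setOf ws) * q₁) _ _ (begin
          avoid lam (groupPiece ts) +ᴿ Ξ lam A′ K (setOf ws) * q₁ ≈⟨ +-congˡ (First.rooted-eq R lam) ⟨
          avoid lam (groupPiece ts) +ᴿ ∏ (rooted lam) ts ≈⟨ avoid-group lam ts ⟨
          ∏ (total lam) ts ≈⟨ First.total-eq R lam ⟩
          Ξ lam A′ K ∅ * q₁ ≈⟨ *-congʳ inclusion-exclusion ⟩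
          (Ξ lam A K ∅ +ᴿ Ξ lam A′ K (setOf ws)) * q₁ ≈⟨ distribʳ _ _ _ ⟩
          Ξ lam A K ∅ * q₁ +ᴿ Ξ lam A′ K (setOf ws) * q₁ ∎)

        -- The only hyperedge to account for is `e ─ ⁅ v ⁆`; it is nonempty and lies in `K`, so no
        -- subset of `M ─ K` contains it.
        outside-K : Ξ lam A′ (M ─ K) ∅ ≈ Ξ lam A (M ─ K) ∅
        outside-K = Ξ-edges lam A′ A (M ─ K) ∅
          (λ U s i g g∈ g⊆ → new s i g⊆ (A-cases g g∈))
          (λ U s i g g∈ → i g (A′⊆A g g∈))
          where
          new : ∀ {U g} → U ≼ M ─ K → Indep A′ U → g ⊆ U → g ≡ e ─ ⁅ v ⁆ ⊎ g ∈ₗ A′ → ⊥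
          new s i g⊆ (inj₁ refl) with ⊈⇒─-nonempty (noLoop e (here refl))
          ... | y , y∈ = ∈─⁻ʳ M K (s y (g⊆ y∈)) (e≼K y y∈)
          new s i g⊆ (inj₂ g∈′) = i _ g∈′ g⊆

        avoid-eq′ : ∏ (avoid lam ∘ groupPiece) (ts ∷ gs) ≈ Ξ lam A (K ∪ M) ∅ * prodZ R Hs lam
        avoid-eq′ = begin
          avoid lam (groupPiece ts) * ∏ (avoid lam ∘ groupPiece) gs
            ≈⟨ *-cong avoid-first (Rest.avoid-eq (λ f f∈ → noLoop f (there f∈)) R lam) ⟩
          (Ξ lam A K ∅ * q₁) * (Ξ lam A′ M ∅ * q₂)
            ≈⟨ *-congˡ (*-congʳ (≈-trans (split A′ M First.hull-closed) (*-cong (reflexive (cong (λ X → Ξ lam A′ X ∅) (∩-comm M K))) outside-K))) ⟩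
          (Ξ lam A K ∅ * q₁) * ((Ξ lam A′ (K ∩ M) ∅ * Ξ lam A (M ─ K) ∅) * q₂)
            ≈⟨ solve 5 (λ a q m r p → ((a :* q) :* ((m :* r) :* p)) := ((a :* r) :* (m :* (q :* p)))) ≈-refl _ q₁ _ _ q₂ ⟩
          (Ξ lam A K ∅ * Ξ lam A (M ─ K) ∅) * (Ξ lam A′ (K ∩ M) ∅ * (q₁ * q₂))
            ≈⟨ *-cong (≈-trans (reflexive (cong (λ X → Ξ lam A X ∅) (∪-comm K M))) (split-∪ A M K-closed)) factors ⟨
          Ξ lam A (K ∪ M) ∅ * prodZ R Hs lam ∎

    avoid-eq : Indep (e ∷ rest) ⁅ v ⁆ → ∀ R lam →
      EqualsProduct R (Sums.∏ R (Sums.avoid R lam ∘ groupPiece) (ts ∷ gs)) (Sums.Ξ R lam A (K ∪ M) ∅) (prodZ R Hs lam)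
    avoid-eq noLoop R lam = avoid-eq′ R lam noLoop

-- The Weitz-hypertree

-- `stepGraph` contracts `v` and all earlier vertices at once, `Chain` one vertex at a time.
contr-contr : ∀ {n} (G : Hypergraph n) S T → contr (contr G S) T ≡ contr G (S ∪ T)
contr-contr {n} G S T = ≡.cong₂ hypergraph (p─q─r≡p─q∪r (verts G) S T) (go (edges G))
  where
  go : ∀ E → contrEdges (contrEdges E S) T ≡ contrEdges E (S ∪ T)
  go [] = refl
  go (e ∷ E) with e ⊆? S | e ⊆? (S ∪ T)
  ... | yes _ | yes _ = go E
  ... | yes e⊆S | no e⊈ = ⊥-elim (e⊈ (λ x∈ → ∈∪⁺ˡ (e⊆S x∈)))
  ... | no _ | yes e⊆ with (e ─ S) ⊆? T
  ...   | yes _ = go E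
  ...   | no e⊈ = ⊥-elim (e⊈ (λ x∈ → [ (λ a → ⊥-elim (∈─⁻ʳ e S x∈ a)) , id ]′ (x∈p∪q⁻ S T (e⊆ (∈─⁻ˡ e S x∈)))))
  go (e ∷ E) | no _ | no e⊈ with (e ─ S) ⊆? T
  ...   | yes s = ⊥-elim (e⊈ sub)
    where
    sub : e ⊆ S ∪ T
    sub {x} x∈ with x ∈? S
    ... | yes a = ∈∪⁺ˡ a
    ... | no a = ∈∪⁺ʳ (s (∈─⁺ x∈ a))
  ...   | no _ = ≡.cong₂ _∷_ (p─q─r≡p─q∪r e S T) (go E)

∈-setOf⁺ : ∀ {n} {x : Fin n} {xs} → x ∈ₗ xs → x ∈ setOf xs
∈-setOf⁺ {x = x} (here refl) = ∈∪⁺ˡ (x∈⁅x⁆ x)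
∈-setOf⁺ (there x∈) = ∈∪⁺ʳ (∈-setOf⁺ x∈)

∈-setOf⁻ : ∀ {n} {x : Fin n} xs → x ∈ setOf xs → x ∈ₗ xs
∈-setOf⁻ [] x∈ = ⊥-elim (∉⊥ x∈)
∈-setOf⁻ (y ∷ xs) x∈ with x∈p∪q⁻ ⁅ y ⁆ (setOf xs) x∈
... | inj₁ a = here (x∈⁅y⁆⇒x≡y y a)
... | inj₂ b = there (∈-setOf⁻ xs b)

-- The vertices contracted before step `j` are those in `take`, so the root of the j-th subtree is
-- still a vertex of its hypergraph.
lookup∉take : ∀ {A : Set} {xs : List A} → Unique xs → ∀ j → lookup xs j ∉ₗ take (toℕ j) xs
lookup∉take (_ ∷ u) zero ()
lookup∉take {xs = x ∷ xs} (x≢ ∷ u) (suc j) (here eq) = All.lookup x≢ (∈-lookup j) (≡.sym eq)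
lookup∉take (_ ∷ u) (suc j) (there ∈take) = lookup∉take u j ∈take

WellFormed-delE : ∀ {n} {H : Hypergraph n} F → WellFormed H → WellFormed (delE H F)
WellFormed-delE {H = H} F wf e e∈ = wf e (proj₁ (∈-delE⁻ H e∈))

WellFormed-contr : ∀ {n} {G : Hypergraph n} S → WellFormed G → WellFormed (contr G S)
WellFormed-contr {G = G} S wf e e∈ with ∈-contr⁻ (edges G) S e∈
... | f , f∈ , f⊈ , refl = ⊈⇒─-nonempty f⊈ , λ x∈ → ∈─⁺ (proj₂ (wf f f∈) (∈─⁻ˡ f S x∈)) (∈─⁻ʳ f S x∈)

WellFormed-induced : ∀ {n} {G : Hypergraph n} {K} → K ≼ verts G → WellFormed G → WellFormed (induced G K)
WellFormed-induced {G = G} {K} K≼V wf e e∈ with ∈-induced⁻ G K≼V e∈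
... | e∈G , inside = proj₁ (wf e e∈G) , λ {x} x∈ → subst (x ∈_) (≡.sym (verts-induced G K≼V)) (inside x x∈ (proj₂ (wf e e∈G) x∈))

-- Every vertex is reachable from v, phrased without paths.
Spanned : ∀ {n} → Hypergraph n → Fin n → Set
Spanned H v = ∀ K → Closed (edges H) K → v ∈ K → verts H ≼ K

reach-closed : ∀ {n} {H : Hypergraph n} {v x K} → Closed (edges H) K → v ∈ K → Reach H v x → x ∈ K
reach-closed cl v∈K (here _) = v∈K
reach-closed cl v∈K (step r e∈ x∈e y∈e) = cl _ e∈ _ x∈e (reach-closed cl v∈K r) _ y∈e

reach-verts : ∀ {n} {H : Hypergraph n} {v x} → WellFormed H → Reach H v x → x ∈ verts H
reach-verts wf (here v∈) = v∈
reach-verts wf (step _ e∈ _ y∈e) = proj₂ (wf _ e∈) y∈e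

module _ {n} {G : Hypergraph n} {w : Fin n} {K : Subset n} (wf : WellFormed G) (K⇔ : ∀ x → (x ∈ K) ⇔ Reach G w x) where

  component-verts : K ≼ verts G
  component-verts x x∈ = reach-verts wf (to (K⇔ x) x∈)

  component-closed : Closed (edges G) K
  component-closed e e∈ x x∈e x∈K y y∈e = from (K⇔ y) (step (to (K⇔ x) x∈K) e∈ x∈e y∈e)

  -- A walk from `w` never leaves `K`, so all its hyperedges survive in the induced hypergraph.
  component-spanned : Spanned (induced G K) w
  component-spanned L cl w∈L x x∈ = go (to (K⇔ x) (subst (x ∈_) (verts-induced G component-verts) x∈))
    where
    go : ∀ {y} → Reach G w y → y ∈ L
    go (here _) = w∈L
    go (step {x} r e∈ x∈e y∈e) = cl _
      (∈-induced⁺ G component-verts e∈ (component-closed _ e∈ x x∈e (from (K⇔ x) r))) x x∈e (go r) _ y∈e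

record ComponentFactorisation {n} (G : Hypergraph n) (w : Fin n) (t : RTree n) : Set₁ where
  constructor componentFactorisation
  field
    carrier : Subset n
    root∈ : w ∈ carrier
    carrier-verts : carrier ≼ verts G
    carrier-closed : Closed (edges G) carrier
    factorisation : Factorisation (induced G carrier) w t

-- `S` accumulates the vertices already contracted, so that each `take` is absorbed into it as the
-- induction moves along `ws`.
tabulate-chain : ∀ {n} (G : Hypergraph n) S ws (ts : Fin (length ws) → RTree n) →
  (∀ j → ComponentFactorisation (contr G (S ∪ setOf (take (toℕ j) ws))) (lookup ws j) (ts j)) →
  Chain (contr G S) ws (tabulate ts)
tabulate-chain G S [] ts f = []
tabulate-chain G S (w ∷ ws) ts f with subst (λ T → ComponentFactorisation (contr G T) w (ts zero)) (∪-identityʳ S) (f zero)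
... | componentFactorisation K w∈K K≼V closed fac = chain K w∈K K≼V closed fac
  (subst (λ G′ → Chain G′ ws (tabulate (ts ∘ suc))) (≡.sym (contr-contr G S ⁅ w ⁆))
    (tabulate-chain G (S ∪ ⁅ w ⁆) ws (ts ∘ suc)
      (λ j → subst (λ T → ComponentFactorisation (contr G T) (lookup ws j) (ts (suc j)))
        (≡.sym (∪-assoc S ⁅ w ⁆ (setOf (take (toℕ j) ws)))) (f (suc j)))))

module _ {n} (H : Hypergraph n) (v : Fin n) where

  record GroupChain (F : List (Subset n)) (e : Subset n) (ts : List (RTree n)) : Set₁ where
    constructor groupChain
    field
      {order} : List (Fin n)
      e∈H : e ∈ₗ edges H
      v∈e : v ∈ e
      order-set : setOf order ≡ e ─ ⁅ v ⁆
      links : Chain (linkAfter H v F) order ts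

  tabulate-groups : ∀ F rest (gs : Fin (length rest) → List (RTree n)) → Unique rest → (∀ e → e ∈ₗ rest → e ∉ₗ F) →
    (∀ i → GroupChain (F ++ take (suc (toℕ i)) rest) (lookup rest i) (gs i)) → Groups H v F rest (tabulate gs)
  tabulate-groups F [] gs u new f = []
  tabulate-groups F (e ∷ rest) gs (e≢ ∷ u) new f with f zero
  ... | groupChain e∈H v∈e eq links = group e∈H v∈e (new e (here refl)) eq links
    (tabulate-groups (F ++ [ e ]) rest (gs ∘ suc) u new′
      (λ i → subst (λ F′ → GroupChain F′ (lookup rest i) (gs (suc i))) (≡.sym (++-assoc F [ e ] (take (suc (toℕ i)) rest))) (f (suc i))))
    where
    new′ : ∀ f → f ∈ₗ rest → f ∉ₗ F ++ [ e ]
    new′ f f∈ f∈F′ with ∈-++⁻ F f∈F′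
    ... | inj₁ a = new f (there f∈) a
    ... | inj₂ (here eq) = All.lookup e≢ f∈ (≡.sym eq)

  module _ (R : CommutativeRing 0ℓ 0ℓ) (lam : Fin n → CommutativeRing.Carrier R) where
    open CommutativeRing R renaming (_+_ to _+ᴿ_; refl to ≈-refl; sym to ≈-sym; trans to ≈-trans) hiding (zero)
    open Sums R

    -- The hyperedge `⁅ v ⁆` yields a group without trees. Its mark is the empty set, which every
    -- set contains, so nothing avoids it.
    avoid-loop : ∀ {F rest gs} → Groups H v F rest gs → ¬ Indep rest ⁅ v ⁆ → ∏ (avoid lam ∘ groupPiece) gs ≈ 0#
    avoid-loop [] ¬i = ⊥-elim (¬i (λ _ ()))
    avoid-loop (group {e = e} {rest} {ws} {ts} _ _ _ eq links others) ¬i with e ⊆? ⁅ v ⁆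
    ... | no e⊈ = ≈-trans (*-congˡ (avoid-loop others (λ i → ¬i (λ { f (here refl) → e⊈ ; f (there f∈) → i f f∈ })))) (zeroʳ _)
    ... | yes e⊆ = ≈-trans (*-congʳ (no-links ws links eq)) (zeroˡ _)
      where
      no-links : ∀ ws {G ts} → Chain G ws ts → setOf ws ≡ e ─ ⁅ v ⁆ → avoid lam (groupPiece ts) ≈ 0#
      -- For no trees, `avoid-group` reads 1 = avoid + 1.
      no-links [] [] _ = GroupProperties.∙-cancelʳ +-group 1# _ _
        (≈-trans (≈-sym (avoid-group lam [])) (≈-sym (+-identityˡ 1#)))
      no-links (w ∷ ws) _ eq = ⊥-elim (∈─⁻ʳ e ⁅ v ⁆ w∈ (e⊆ (∈─⁻ˡ e ⁅ v ⁆ w∈)))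
        where w∈ = subst (w ∈_) eq (∈-setOf⁺ {xs = w ∷ ws} (here refl))

  module _ {es gs} (wf : WellFormed H) (span : Spanned H v) (v∈V : v ∈ verts H)
    (es⇔ : ∀ e → (e ∈ₗ es) ⇔ (e ∈ₗ edges H × v ∈ e)) (groups : Groups H v [] es gs) where

    assemble-factorisation : Factorisation H v (assemble v gs)
    assemble-factorisation = record
      { cofactors = Whole.cofactors
      ; cofactors-sub = Whole.cofactors-sub
      ; cofactors-avoid = Whole.cofactors-avoid
      ; total-eq = total-eq
      ; rooted-eq = rooted-eq
      }
      where
      ne : EdgesNonempty (edges H)
      ne e e∈ = proj₁ (wf e e∈)

      module Whole = GroupsFactorisation
        (groups-factorisation H v ne (λ _ ()) (λ f f∈ v∈f → inj₂ (from (es⇔ f) (f∈ , v∈f))) groups)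
      M = Whole.hull
      V′ = verts H ─ ⁅ v ⁆

      A≡ : edges (linkAfter H v []) ≡ contrEdges (edges H) ⁅ v ⁆
      A≡ = cong (λ E → contrEdges E ⁅ v ⁆) (filter-all (λ e → ¬? (DecMem._∈?_ _≟ₛ_ e [])) (All.universal (λ _ ()) (edges H)))

      M∪v-closed : Closed (edges H) (M ∪ ⁅ v ⁆)
      M∪v-closed f f∈ x x∈f x∈ y y∈f with v ∈? f
      ... | yes v∈f with y ∈? ⁅ v ⁆
      ...   | yes y∈v = ∈∪⁺ʳ y∈v
      ...   | no y∉v = ∈∪⁺ˡ (Whole.hull-covers f (from (es⇔ f) (f∈ , v∈f)) y (∈─⁺ y∈f y∉v))
      M∪v-closed f f∈ x x∈f x∈ y y∈f | no v∉f with x∈p∪q⁻ M ⁅ v ⁆ x∈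
      ...   | inj₂ x∈v = ⊥-elim (v∉f (subst (_∈ f) (x∈⁅y⁆⇒x≡y v x∈v) x∈f))
      ...   | inj₁ x∈M = ∈∪⁺ˡ (Whole.hull-closed f f∈A x x∈f x∈M y y∈f)
        where
        f∈A : f ∈ₗ edges (linkAfter H v [])
        f∈A = subst (f ∈ₗ_) (≡.sym A≡) (subst (_∈ₗ contrEdges (edges H) ⁅ v ⁆) (─-∉ v∉f)
          (∈-contr⁺ (edges H) ⁅ v ⁆ f∈ (λ s → v∉f (subst (_∈ f) (x∈⁅y⁆⇒x≡y v (s x∈f)) x∈f))))

      -- Here connectedness enters: `M` together with `v` is closed and contains `v`, hence is
      -- everything. The identities on the hull thus become identities for H - v and H ⊖ v.
      M≡V′ : M ≡ V′
      M≡V′ = ≼-antisym Whole.hull-verts (λ x x∈ →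
        [ id , (λ x∈v → ⊥-elim (∈─⁻ʳ (verts H) ⁅ v ⁆ x∈ x∈v)) ]′
          (x∈p∪q⁻ M ⁅ v ⁆ (span (M ∪ ⁅ v ⁆) M∪v-closed (∈∪⁺ʳ (x∈⁅x⁆ v)) x (∈─⁻ˡ (verts H) ⁅ v ⁆ x∈))))

      module _ (R : CommutativeRing 0ℓ 0ℓ) (lam : Fin n → CommutativeRing.Carrier R) where
        open CommutativeRing R renaming (_+_ to _+ᴿ_; refl to ≈-refl; sym to ≈-sym; trans to ≈-trans) hiding (zero)
        open import Relation.Binary.Reasoning.Setoid setoid
        open Sums R

        q = prodZ R Whole.cofactors lam

        ⁅v⁆≡ : Ξ lam (edges H) (verts H) ⁅ v ⁆ ≈ Ξ lam (edges H) (verts H) (⁅ v ⁆ ∪ ∅)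
        ⁅v⁆≡ = reflexive (cong (Ξ lam (edges H) (verts H)) (≡.sym (∪-identityʳ ⁅ v ⁆)))

        root-in : lam v * ∏ (avoid lam ∘ groupPiece) gs ≈ Ξ lam (edges H) (verts H) ⁅ v ⁆ * q
        root-in with indep? es ⁅ v ⁆
        ... | no loop = begin
          lam v * ∏ (avoid lam ∘ groupPiece) gs ≈⟨ *-congˡ (avoid-loop R lam groups loop) ⟩
          lam v * 0# ≈⟨ zeroʳ _ ⟩
          0# ≈⟨ zeroˡ _ ⟨
          0# * q ≈⟨ *-congʳ (Ξ-loop lam (edges H) (verts H) ⁅ v ⁆ {T = ⁅ v ⁆} (λ i → loop (λ e e∈ → i e (proj₁ (to (es⇔ e) e∈)))) (λ _ a → a)) ⟨
          Ξ lam (edges H) (verts H) ⁅ v ⁆ * q ∎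
        ... | yes i = begin
          lam v * ∏ (avoid lam ∘ groupPiece) gs ≈⟨ *-congˡ (Whole.avoid-eq i R lam) ⟩
          lam v * (Ξ lam (edges (linkAfter H v [])) M ∅ * q) ≈⟨ *-assoc _ _ _ ⟨
          (lam v * Ξ lam (edges (linkAfter H v [])) M ∅) * q ≈⟨ *-congʳ (*-congˡ (reflexive (≡.cong₂ (λ A B → Ξ lam A B ∅) A≡ M≡V′))) ⟩
          (lam v * Ξ lam (contrEdges (edges H) ⁅ v ⁆) V′ ∅) * q ≈⟨ *-congʳ (≈-trans ⁅v⁆≡ (Ξ-contr lam (edges H) (verts H) ∅ v∈V ∉⊥ noLoop)) ⟨
          Ξ lam (edges H) (verts H) ⁅ v ⁆ * q ∎
          where
          noLoop : Indep (edges H) ⁅ v ⁆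
          noLoop e e∈ e⊆ with ne e e∈
          ... | y , y∈ = i e (from (es⇔ e) (e∈ , subst (_∈ e) (x∈⁅y⁆⇒x≡y v (e⊆ y∈)) y∈)) e⊆

        rooted-eq : rooted lam (assemble v gs) ≈ Ξ lam (edges H) (verts H) ⁅ v ⁆ * q
        rooted-eq = ≈-trans (rooted-assemble lam v gs) root-in

        root-out : Ξ lam (edges H) V′ ∅ ≈ Ξ lam (edges (delV H ⁅ v ⁆)) V′ ∅
        root-out = Ξ-edges lam (edges H) (edges (delV H ⁅ v ⁆)) V′ ∅
          (λ U s i e e∈ → i e (proj₁ (∈-delV⁻ H e∈)))
          (λ U s i e e∈ e⊆ → i e (∈-delV⁺ H e∈ (λ v∈e → ∈─⁻ʳ (verts H) ⁅ v ⁆ (s v (e⊆ v∈e)) (x∈⁅x⁆ v))) e⊆)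

        -- Going through `Ξ-contr` would exclude a hyperedge `⁅ v ⁆`; expanding both the full sum
        -- and its occupied part at `v` needs no case distinction.
        expand : Ξ lam (edges H) (verts H) ∅ ≈ Ξ lam (edges H) (verts H) ⁅ v ⁆ +ᴿ Ξ lam (edges (delV H ⁅ v ⁆)) V′ ∅
        expand = begin
          Ξ lam (edges H) (verts H) ∅ ≈⟨ W-expand lam (verts H) v (admissible? (edges H) ∅) v∈V ⟩
          lam v * W lam V′ (λ U → admissible? (edges H) ∅ (U ∪ ⁅ v ⁆)) +ᴿ Ξ lam (edges H) V′ ∅
            ≈⟨ +-cong (*-congˡ (W-cong lam V′ _ (λ U → admissible? (edges H) ⁅ v ⁆ (U ∪ ⁅ v ⁆))
                 (λ U _ → mk⇔ (λ (i , _) → i , λ x → ∈∪⁺ʳ) (λ (i , _) → i , λ x x∈ → ⊥-elim (∉⊥ x∈))))) root-out ⟩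
          lam v * W lam V′ (λ U → admissible? (edges H) ⁅ v ⁆ (U ∪ ⁅ v ⁆)) +ᴿ Ξ lam (edges (delV H ⁅ v ⁆)) V′ ∅
            ≈⟨ +-congʳ (≈-trans (W-expand lam (verts H) v (admissible? (edges H) ⁅ v ⁆) v∈V)
                 (≈-trans (+-congˡ (W-none lam V′ (admissible? (edges H) ⁅ v ⁆)
                   (λ U s (_ , t) → ∈─⁻ʳ (verts H) ⁅ v ⁆ (s (t v (x∈⁅x⁆ v))) (x∈⁅x⁆ v)))) (+-identityʳ _))) ⟨
          Ξ lam (edges H) (verts H) ⁅ v ⁆ +ᴿ Ξ lam (edges (delV H ⁅ v ⁆)) V′ ∅ ∎

        total-eq : total lam (assemble v gs) ≈ Ξ lam (edges H) (verts H) ∅ * q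
        total-eq = begin
          total lam (assemble v gs) ≈⟨ total-assemble lam v gs ⟩
          lam v * ∏ (avoid lam ∘ groupPiece) gs +ᴿ ∏ (∏ (total lam)) gs
            ≈⟨ +-cong root-in (≈-trans (Whole.total-eq R lam) (*-congʳ (reflexive (cong (λ X → Ξ lam (edges (delV H ⁅ v ⁆)) X ∅) M≡V′)))) ⟩
          Ξ lam (edges H) (verts H) ⁅ v ⁆ * q +ᴿ Ξ lam (edges (delV H ⁅ v ⁆)) V′ ∅ * q ≈⟨ distribʳ _ _ _ ⟨
          (Ξ lam (edges H) (verts H) ⁅ v ⁆ +ᴿ Ξ lam (edges (delV H ⁅ v ⁆)) V′ ∅) * q ≈⟨ *-congʳ expand ⟨
          Ξ lam (edges H) (verts H) ∅ * q ∎

trivial-factorisation : ∀ {n} (H : Hypergraph n) v → Factorisation H v (rtree n H v id)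
trivial-factorisation {n} H v = record
  { cofactors = []
  ; cofactors-sub = []
  ; cofactors-avoid = []
  ; total-eq = total-eq
  ; rooted-eq = rooted-eq
  }
  where
  module _ (R : CommutativeRing 0ℓ 0ℓ) (lam : Fin n → CommutativeRing.Carrier R) where
    open CommutativeRing R hiding (refl)
    open Sums R

    total-eq : total lam (rtree n H v id) ≈ Ξ lam (edges H) (verts H) ∅ * 1#
    total-eq = trans (sym (Ξ-∅ lam (edges H) (verts H))) (sym (*-identityʳ _))

    rooted-eq : rooted lam (rtree n H v id) ≈ Ξ lam (edges H) (verts H) ⁅ v ⁆ * 1#
    rooted-eq = trans
      (W-cong lam (verts H) _ (admissible? (edges H) ⁅ v ⁆)
        (λ U _ → mk⇔ (λ (i , c) → i , c ⁅ v ⁆ (here refl)) (λ (i , s) → i , λ { e (here refl) → s })))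
      (sym (*-identityʳ _))

-- The induction asks of connectedness only that `v` reach every vertex, which the component of a
-- vertex provides by construction.
weitz-factorisation : ∀ {n} {H : Hypergraph n} {v t} → WellFormed H → Spanned H v → v ∈ verts H → Weitz H v t → Factorisation H v t
weitz-factorisation {H = H} {v} wf span v∈V (base _) = trivial-factorisation H v
weitz-factorisation {n} {H} {v} wf span v∈V (step _ es es! es⇔ ws ws! ws⇔ sub subtrees) =
  assemble-factorisation H v wf span v∈V es⇔
    (tabulate-groups H v [] es _ es! (λ _ _ ()) (λ i → groupChain
      (proj₁ (to (es⇔ _) (∈-lookup i))) (proj₂ (to (es⇔ _) (∈-lookup i))) (ws-set i)
      (tabulate-chain (delE H (take (suc (toℕ i)) es)) ⁅ v ⁆ (ws i) (sub i) (λ j → component i j (subtrees i j)))))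
  where
  ws-set : ∀ i → setOf (ws i) ≡ lookup es i ─ ⁅ v ⁆
  ws-set i = ≼-antisym
    (λ x x∈ → let x∈e , x≢v = to (ws⇔ i x) (∈-setOf⁻ (ws i) x∈) in ∈─⁺ x∈e (λ x∈v → x≢v (x∈⁅y⁆⇒x≡y v x∈v)))
    (λ x x∈ → ∈-setOf⁺ (from (ws⇔ i x) (∈─⁻ˡ (lookup es i) ⁅ v ⁆ x∈ ,
      λ { refl → ∈─⁻ʳ (lookup es i) ⁅ v ⁆ x∈ (x∈⁅x⁆ v) })))

  component : ∀ i j → Σ[ C ∈ Hypergraph n ]
      (Component (stepGraph H v es i (ws i) (toℕ j)) (lookup (ws i) j) C × Weitz C (lookup (ws i) j) (sub i j)) →
    ComponentFactorisation (stepGraph H v es i (ws i) (toℕ j)) (lookup (ws i) j) (sub i j)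
  component i j (_ , (K , K⇔ , refl) , weitz) = componentFactorisation K w∈K K≼V (component-closed wf′ K⇔)
    (weitz-factorisation (WellFormed-induced K≼V wf′) (component-spanned wf′ K⇔)
      (subst (w ∈_) (≡.sym (verts-induced G K≼V)) w∈K) weitz)
    where
    w = lookup (ws i) j
    G = stepGraph H v es i (ws i) (toℕ j)
    wf′ : WellFormed G
    wf′ = WellFormed-contr _ (WellFormed-delE _ wf)
    K≼V : K ≼ verts G
    K≼V = component-verts wf′ K⇔
    w∈e : w ∈ lookup es i × w ≢ v
    w∈e = to (ws⇔ i w) (∈-lookup j)
    w∈G : w ∈ verts G
    w∈G = ∈─⁺ (proj₂ (wf _ (proj₁ (to (es⇔ _) (∈-lookup i)))) (proj₁ w∈e))
      (λ w∈ → [ (λ a → proj₂ w∈e (x∈⁅y⁆⇒x≡y v a)) , (λ b → lookup∉take (ws! i) j (∈-setOf⁻ _ b)) ]′ (x∈p∪q⁻ ⁅ v ⁆ _ w∈))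
    w∈K : w ∈ K
    w∈K = from (K⇔ w) (here w∈G)

theorem2p8 : ∀ {n} (H : Hypergraph n) (v : Fin n) (t : RTree n) →
    WellFormed H → Connected H → v ∈ verts H → Weitz H v t →
    ((R : CommutativeRing 0ℓ 0ℓ) (lam : Fin n → CommutativeRing.Carrier R) →
    CommutativeRing._≈_ R (Z R H lam) (CommutativeRing.0# R) →
    CommutativeRing._≈_ R (Z R (hg t) (lam ∘ lab t)) (CommutativeRing.0# R))
    × (Σ[ Hs ∈ List (Hypergraph n × ℕ) ]
    (All (λ p → IsSub H (proj₁ p) × (∀ u → u ∈ verts (proj₁ p) → u ∈ verts H × u ≢ v) × 1 ≤ proj₂ p) Hs
    × ((R : CommutativeRing 0ℓ 0ℓ) (lam : Fin n → CommutativeRing.Carrier R) →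
    CommutativeRing._≈_ R (Z R (hg t) (lam ∘ lab t))
    (CommutativeRing._*_ R (Z R H lam) (prodZ R Hs lam)))))
theorem2p8 {n} H v t wf connected v∈V weitz = vanishing , cofactors , All.zipWith admissible (cofactors-sub , cofactors-avoid) , product
  where
  open Factorisation (weitz-factorisation wf (λ K cl v∈K x x∈ → reach-closed cl v∈K (connected v x v∈V x∈)) v∈V weitz)

  admissible : ∀ {p} → (IsSub H (proj₁ p) × 1 ≤ proj₂ p) × v ∉ verts (proj₁ p) →
    IsSub H (proj₁ p) × (∀ u → u ∈ verts (proj₁ p) → u ∈ verts H × u ≢ v) × 1 ≤ proj₂ p
  admissible ((s , 1≤k) , v∉) = s , (λ u u∈ → IsSub-verts s u u∈ , λ { refl → v∉ u∈ }) , 1≤k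

  product : (R : CommutativeRing 0ℓ 0ℓ) (lam : Fin n → CommutativeRing.Carrier R) →
    CommutativeRing._≈_ R (Z R (hg t) (lam ∘ lab t)) (CommutativeRing._*_ R (Z R H lam) (prodZ R cofactors lam))
  product R lam = trans (Z≈W (hg t) (lam ∘ lab t)) (trans (total-eq R lam) (*-congʳ (sym (Z≈Ξ H lam))))
    where
    open CommutativeRing R
    open Sums R

  vanishing : (R : CommutativeRing 0ℓ 0ℓ) (lam : Fin n → CommutativeRing.Carrier R) →
    CommutativeRing._≈_ R (Z R H lam) (CommutativeRing.0# R) →
    CommutativeRing._≈_ R (Z R (hg t) (lam ∘ lab t)) (CommutativeRing.0# R)
  vanishing R lam Z≈0 = trans (product R lam) (trans (*-congʳ Z≈0) (zeroˡ _))
    where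
    open CommutativeRing R
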